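{- Identify colorings $x : T \to \{0,1\}$ with points of the Cantor space $\{0,1\}^{\mathbb{N}}$ via a fixed computable enumeration of $T$. Then the set $\mathcal{W} \subseteq \{0,1\}^T$ of colorings that are winning for black is $\Delta^0_5$ in the lightface (effective) Borel hierarchy, and hence $\mathbf{\Delta}^0_5$ in the boldface Borel hierarchy.
   Context: Fix a regular hexagonal tiling of $\mathbb{R}^2$ in which some tile edges are horizontal, and let $T$ be its set of tiles. Two tiles are adjacent if they share an edge. A coloring is a map $x : T \to \{0,1\}$; tiles with $x(t)=1$ are black, the others vacant. A path is a sequence of tiles $(t_i)_{i\in I}$, $I\subseteq\mathbb{Z}$ an interval, with consecutive tiles adjacent; it is black if all its tiles are black. Fix a sequence of tiles $(d_n)_{n\in\mathbb{Z}}$ with each $d_n$ the northeast neighbour of $d_{n-1}$. The northeast quarter-plane $Q^+_n$ is the set of tiles obtained from $d_n$ by translations by vectors in $[0,\infty)^2$, and the southwest quarter-plane $Q^-_n$ the set of tiles obtained from $d_n$ by translations by vectors in $(-\infty,0]^2$. For $*\in\{+,-\}$, a one-way infinite path $(t_i)_{i\in\mathbb{N}}$ reaches to $*$ if for every $n$ there is $i$ with $t_j\in Q^*_n$ for all $j\ge i$. A coloring is winning for black if there are black paths $(t_i)_{i\in\mathbb{N}}$ and $(s_i)_{i\in\mathbb{N}}$ with $t_0=s_0$ such that $(t_i)$ reaches to $+$ and $(s_i)$ reaches to $-$. $\Delta^0_5=\Sigma^0_5\cap\Pi^0_5$ in the effective Borel hierarchy, where $\Sigma^0_1$ sets are effectively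 open sets and $\Sigma^0_{k+1}$ sets are computable unions of $\Pi^0_k$ sets, $\Pi^0_k$ being complements of $\Sigma^0_k$ sets; the boldface classes are defined analogously with arbitrary countable unions. -}

module Defs where

open import Level using (0ℓ)
open import Data.Bool using (Bool)
open import Data.Nat using (ℕ; zero; suc; _≤_)
open import Data.Integer as ℤ using (ℤ; +_; -[1+_]; 0ℤ; 1ℤ; -1ℤ)
open import Data.Product using (Σ; ∃; ∃-syntax; _×_; _,_)
open import Data.Sum using (_⊎_)
open import Data.Unit using (⊤)
open import Data.List using (List; []; _∷_)
open import Data.Maybe using (Maybe; just)
open import Relation.Nullary using (¬_)
open import Relation.Binary.PropositionalEquality using (_≡_)
open import Function.Bundles using (_↔_; Inverse)
open import Axiom.ExcludedMiddle using (ExcludedMiddle)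

-- The hexagonal tiling.
-- Tiles are indexed by axial coordinates (q , r) ∈ ℤ × ℤ.  With tile side s
-- the centre of (q , r) is ( (3/2) q s , (√3/2) (2r + q) s ), so some tile
-- edges are horizontal.  Neighbours: (q±1, r), (q, r±1), (q+1, r-1), (q-1, r+1).
-- Direction (1,0) is the northeast neighbour, (0,1) north, (1,-1) southeast.

Tile : Set
Tile = ℤ × ℤ

-- the "height" coordinate, proportional to the y-coordinate of the centre
hgt : Tile → ℤ
hgt (q , r) = (r ℤ.+ r) ℤ.+ q

data Step : ℤ → ℤ → Set where
  ne : Step 1ℤ 0ℤ
  sw : Step -1ℤ 0ℤ
  n  : Step 0ℤ 1ℤ
  s  : Step 0ℤ -1ℤ
  se : Step 1ℤ -1ℤ
  nw : Step -1ℤ 1ℤ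

Adjacent : Tile → Tile → Set
Adjacent (q , r) (q' , r') = Step (q' ℤ.- q) (r' ℤ.- r)

Coloring : Set
Coloring = Tile → Bool

IsPath : (ℕ → Tile) → Set
IsPath t = ∀ i → Adjacent (t i) (t (suc i))

IsBlack : Coloring → (ℕ → Tile) → Set
IsBlack x t = ∀ i → x (t i) ≡ Data.Bool.true

diag : Tile → ℤ → Tile
diag (q , r) m = (q ℤ.+ m , r)

-- Q⁺_n: tiles t with centre(t) - centre(d_n) ∈ [0,∞)²
InQ⁺ : Tile → ℤ → Tile → Set
InQ⁺ d0 m t = let (q , _) = t ; (qn , _) = diag d0 m in
  (qn ℤ.≤ q) × (hgt (diag d0 m) ℤ.≤ hgt t)

-- Q⁻_n: tiles t with centre(t) - centre(d_n) ∈ (-∞,0]²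
InQ⁻ : Tile → ℤ → Tile → Set
InQ⁻ d0 m t = let (q , _) = t ; (qn , _) = diag d0 m in
  (q ℤ.≤ qn) × (hgt t ℤ.≤ hgt (diag d0 m))

ReachesTo : (Tile → ℤ → Tile → Set) → Tile → (ℕ → Tile) → Set
ReachesTo Q d0 t = ∀ (m : ℤ) → ∃[ i ] (∀ j → i ≤ j → Q d0 m (t j))

Winning : Tile → Coloring → Set
Winning d0 x = ∃[ t ] ∃[ s ]
  ( IsPath t × IsBlack x t × ReachesTo InQ⁺ d0 t
  × IsPath s × IsBlack x s × ReachesTo InQ⁻ d0 s
  × (t 0 ≡ s 0) )

Cantor : Set
Cantor = ℕ → Bool

Prefix : List Bool → Cantor → Set
Prefix [] α = ⊤
Prefix (b ∷ w) α = (α 0 ≡ b) × Prefix w (λ k → α (suc k))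

-- ΣCode k codes a Σ⁰_(k+1) set.
-- Level 1: a (computable) enumeration of basic cylinders (nothing ↦ no cylinder).
-- Level k+2: a (computable) sequence of Π⁰_(k+1) codes, i.e. of Σ⁰_(k+1) codes
-- read as complements.
ΣCode : ℕ → Set
ΣCode zero = ℕ → Maybe (List Bool)
ΣCode (suc k) = ℕ → ΣCode k

InΣ : (k : ℕ) → ΣCode k → Cantor → Set
InΣ zero c α = ∃[ i ] ∃[ w ] ((c i ≡ just w) × Prefix w α)
InΣ (suc k) c α = ∃[ i ] (¬ InΣ k (c i) α)

InΠ : (k : ℕ) → ΣCode k → Cantor → Set
InΠ k c α = ¬ InΣ k c α

W : ℕ ↔ Tile → Tile → Cantor → Set
W e d0 α = Winning d0 (λ t → α (Inverse.from e t))

-- Lightface Δ⁰_(k+1): there are (computable, i.e. given by closed Agda terms)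
-- Σ⁰_(k+1) and Π⁰_(k+1) codes for the set; correctness of the codes is
-- verified in classical logic.
LightfaceΔ : (k : ℕ) → (Cantor → Set) → Set₁
LightfaceΔ k A = Σ (ΣCode k) λ c → Σ (ΣCode k) λ d →
  (ExcludedMiddle 0ℓ →
    (∀ α → (A α → InΣ k c α) × (InΣ k c α → A α))
    × (∀ α → (A α → InΠ k d α) × (InΠ k d α → A α)))

{-# OPTIONS --safe #-}
module Submission where

-- A black path reaching to + meets, for every n, a component of the black tiles of the quarter-plane Q n,
-- and these components are nested; conversely a nested sequence of components gives a path.  The tree of
-- components may branch infinitely, which is why a naive reading only gives a Σ¹₁ definition.  Say that a
-- component hugs a side (vertical V, horizontal H) if it is infinite in a strip of finite width along that
-- side; hugging is Σ⁰₃ and is inherited by larger components.  A component with infinitely many relevant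
-- children must hug a side.  Planarity enters through one lemma (blocks): if a component C hugs side i up to
-- distance b, then a component that leaves the boundary of Q n before C (in the direction of that side)
-- cannot go to infinity at distance at least b from the side without meeting C.  Since a winning path is also
-- connected to the opposite quarter-plane, only components attached to the boundary of Q 0 matter, and the
-- lemma implies, for each set c of sides hugged along the path: (1) components hugging the sides in c
-- exist at all levels (Plenty, Π⁰₄), and (2) from some level on, all of them lie in one component, which does
-- not hug the other sides and is connected to the starting tile (Leads, Σ⁰₄); and (1) and (2) let one descend
-- for ever, by König's lemma.  So the winning set is a finite union of sets Π⁰₄ ∩ Σ⁰₄.

open import Algebra.Bundles using (CommutativeRing)
open import Algebra.Properties.CommutativeSemigroup using (interchange)
open import Axiom.ExcludedMiddle using (ExcludedMiddle)
open import Data.Bool using (Bool; true; false; _∧_; _xor_; not)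
open import Data.Bool.Properties using (xor-same; xor-comm; xor-identityʳ; xor-∧-commutativeRing) renaming (_≟_ to _≟ᵇ_)
open import Data.Empty using (⊥; ⊥-elim)
open import Data.Integer using (ℤ; +_; -[1+_]; 0ℤ; 1ℤ; -1ℤ; _-_; -_; +≤+; -≤+; ∣_∣) renaming (_+_ to _+ℤ_; _≤_ to _≤ℤ_; _<_ to _<ℤ_)
import Data.Integer.Properties as ℤₚ
open import Data.Integer.Tactic.RingSolver using (solve-∀)
open import Data.List using (List; []; _∷_; length; upTo; cartesianProduct) renaming (map to mapₗ; _++_ to _++ₗ_)
open import Data.List.Membership.Propositional using (_∈_)
open import Data.List.Membership.Propositional.Properties using (∈-map⁺; ∈-++⁺ˡ; ∈-++⁺ʳ; ∈-upTo⁺; ∈-cartesianProduct⁺)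
open import Data.List.Relation.Unary.Any using (here; there)
open import Data.Maybe using (Maybe; just; nothing)
open import Data.Nat using (ℕ; zero; suc; _⊔_; _∸_; _≤_; _<_; z≤n; s≤s) renaming (_+_ to _+ℕ_)
import Data.Nat.Properties as ℕₚ
open import Data.Product using (∃-syntax; _×_; _,_; proj₁; proj₂; map)
open import Data.Product.Properties using (≡-dec)
open import Data.Sum using (_⊎_; inj₁; inj₂; [_,_]′)
open import Data.Unit using (tt)
open import Function using (_∘_; id)
open import Function.Bundles using (_↔_; Inverse)
open import Level using (0ℓ)
open import Relation.Binary.PropositionalEquality using (_≡_; _≢_; refl; sym; trans; cong; cong₂; subst; subst₂; module ≡-Reasoning)
open import Relation.Nullary using (¬_; Dec; yes; no; ¬?; _×-dec_)

open import Defs renaming (n to north; s to south)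

EM : Set₁
EM = ExcludedMiddle 0ℓ

stable : EM → {A : Set} → ¬ ¬ A → A
stable em {A} ¬¬a with em {A}
... | yes a = a
... | no ¬a = ⊥-elim (¬¬a ¬a)

¬∀⇒∃¬ : EM → {I : Set} {A : I → Set} → ¬ (∀ i → A i) → ∃[ i ] ¬ A i
¬∀⇒∃¬ em h = stable em λ k → h λ i → stable em λ ¬a → k (i , ¬a)

infix 3 _⇔_
_⇔_ : Set → Set → Set
A ⇔ B = (A → B) × (B → A)

-- Countable types

record Countable (I : Set) : Set where
  field
    enum : ℕ → I
    index : I → ℕ
    enum-index : ∀ i → enum (index i) ≡ i

open Countable

ℕ-countable : Countable ℕ
ℕ-countable .enum = id
ℕ-countable .index = id
ℕ-countable .enum-index _ = refl

Bool-countable : Countable Bool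
Bool-countable .enum zero = true
Bool-countable .enum (suc _) = false
Bool-countable .index true = 0
Bool-countable .index false = 1
Bool-countable .enum-index true = refl
Bool-countable .enum-index false = refl

image-countable : {I J : Set} (f : I → J) (g : J → I) → (∀ j → f (g j) ≡ j) → Countable I → Countable J
image-countable f g fg c .enum k = f (enum c k)
image-countable f g fg c .index j = index c (g j)
image-countable f g fg c .enum-index j = trans (cong f (enum-index c (g j))) (fg j)

next : ℕ × ℕ → ℕ × ℕ
next (zero , b) = suc b , 0
next (suc a , b) = a , suc b

unpair : ℕ → ℕ × ℕ
unpair zero = 0 , 0
unpair (suc k) = next (unpair k)

-- unpair runs through the antidiagonals, starting each of them at (d , 0).
unpair-surjective : ∀ d a b → a +ℕ b ≡ d → ∃[ k ] unpair k ≡ (a , b)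
unpair-surjective zero zero zero refl = 0 , refl
unpair-surjective (suc d) a zero eq with trans (sym (ℕₚ.+-identityʳ a)) eq
... | refl with unpair-surjective d 0 d refl
... | k , e = suc k , cong next e
unpair-surjective (suc d) a (suc b) eq with unpair-surjective (suc d) (suc a) b (trans (sym (ℕₚ.+-suc a b)) eq)
... | k , e = suc k , cong next e

×-countable : {I J : Set} → Countable I → Countable J → Countable (I × J)
×-countable {I} {J} c d = image-countable {ℕ × ℕ} (map (enum c) (enum d)) (map (index c) (index d))
  (λ (i , j) → cong₂ _,_ (enum-index c i) (enum-index d j)) record
  { enum = unpair
  ; index = λ (a , b) → proj₁ (unpair-surjective (a +ℕ b) a b refl)
  ; enum-index = λ (a , b) → proj₂ (unpair-surjective (a +ℕ b) a b refl) }

ℤ-countable : Countable ℤ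
ℤ-countable = image-countable to from to-from (×-countable Bool-countable ℕ-countable)
  where
  to : Bool × ℕ → ℤ
  to (true , k) = + k
  to (false , k) = -[1+ k ]
  from : ℤ → Bool × ℕ
  from (+ k) = true , k
  from -[1+ k ] = false , k
  to-from : ∀ z → to (from z) ≡ z
  to-from (+ _) = refl
  to-from -[1+ _ ] = refl

List-countable : {I : Set} → Countable I → Countable (List I)
List-countable {I} c = image-countable {ℕ × ℕ} (λ (l , k) → decode l k) (λ is → length is , encode is) decode-encode
  (×-countable ℕ-countable ℕ-countable)
  where
  c×ℕ : Countable (I × ℕ)
  c×ℕ = ×-countable c ℕ-countable
  decode : ℕ → ℕ → List I
  decode zero _ = []
  decode (suc l) k = proj₁ (enum c×ℕ k) ∷ decode l (proj₂ (enum c×ℕ k))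
  encode : List I → ℕ
  encode [] = 0
  encode (i ∷ is) = index c×ℕ (i , encode is)
  decode-encode : ∀ is → decode (length is) (encode is) ≡ is
  decode-encode [] = refl
  decode-encode (i ∷ is) = trans
    (cong (λ (j , k) → j ∷ decode (length is) k) (enum-index c×ℕ (i , encode is)))
    (cong (i ∷_) (decode-encode is))

-- The effective Borel hierarchy: as in ΣCode, IsΣ k and IsΠ k are the classes Σ⁰_(k+1) and Π⁰_(k+1).

record IsΣ (k : ℕ) (A : Cantor → Set) : Set₁ where
  constructor mkΣ
  field
    codeΣ : ΣCode k
    correctΣ : EM → ∀ α → A α ⇔ InΣ k codeΣ α

record IsΠ (k : ℕ) (A : Cantor → Set) : Set₁ where
  constructor mkΠ
  field
    codeΠ : ΣCode k
    correctΠ : EM → ∀ α → A α ⇔ InΠ k codeΠ α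

open IsΣ
open IsΠ

module _ {k : ℕ} {A B : Cantor → Set} where

  Σ-resp : (EM → ∀ α → A α ⇔ B α) → IsΣ k A → IsΣ k B
  Σ-resp eq a .codeΣ = codeΣ a
  Σ-resp eq a .correctΣ em α =
    proj₁ (correctΣ a em α) ∘ proj₂ (eq em α) , proj₁ (eq em α) ∘ proj₂ (correctΣ a em α)

  Π-resp : (EM → ∀ α → A α ⇔ B α) → IsΠ k A → IsΠ k B
  Π-resp eq a .codeΠ = codeΠ a
  Π-resp eq a .correctΠ em α =
    proj₁ (correctΠ a em α) ∘ proj₂ (eq em α) , proj₁ (eq em α) ∘ proj₂ (correctΠ a em α)

module _ {k : ℕ} {A : Cantor → Set} where

  Π-¬ : IsΣ k A → IsΠ k (λ α → ¬ A α)
  Π-¬ a .codeΠ = codeΣ a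
  Π-¬ a .correctΠ em α = (λ ¬a → ¬a ∘ proj₂ (correctΣ a em α)) , (λ ¬c → ¬c ∘ proj₁ (correctΣ a em α))

  Σ-¬ : IsΠ k A → IsΣ k (λ α → ¬ A α)
  Σ-¬ a .codeΣ = codeΠ a
  Σ-¬ a .correctΣ em α =
    (λ ¬a → stable em (¬a ∘ proj₂ (correctΠ a em α))) , (λ c x → proj₁ (correctΠ a em α) x c)

  Σ⇒Π : IsΣ k A → IsΠ (suc k) A
  Σ⇒Π a .codeΠ _ = codeΣ a
  Σ⇒Π a .correctΠ em α =
    (λ x (_ , ¬c) → ¬c (proj₁ (correctΣ a em α) x)) , (λ h → proj₂ (correctΣ a em α) (stable em λ ¬c → h (0 , ¬c)))

  Π⇒Σ : IsΠ k A → IsΣ (suc k) A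
  Π⇒Σ a .codeΣ _ = codeΠ a
  Π⇒Σ a .correctΣ em α = (λ x → 0 , proj₁ (correctΠ a em α) x) , (λ (_ , ¬c) → proj₂ (correctΠ a em α) ¬c)

module _ {I : Set} (count : Countable I) {A : I → Cantor → Set} where

  private
    ij : Countable (I × ℕ)
    ij = ×-countable count ℕ-countable

  -- A union of unions is one union, indexed by pairs. The code is formed without `em`; only its
  -- correctness may be classical, as the lightface class demands.
  Σ-∃ : ∀ {k} → (∀ i → IsΣ k (A i)) → IsΣ k (λ α → ∃[ i ] A i α)
  Σ-∃ {zero} a .codeΣ m = let (i , j) = enum ij m in codeΣ (a i) j
  Σ-∃ {zero} a .correctΣ em α =
    (λ (i , x) → let (j , w , eq , p) = proj₁ (correctΣ (a i) em α) x in
      index ij (i , j) , w , trans (cong (λ (i , j) → codeΣ (a i) j) (enum-index ij (i , j))) eq , p) ,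
    (λ (m , c) → let (i , j) = enum ij m in i , proj₂ (correctΣ (a i) em α) (j , c))
  Σ-∃ {suc k} a .codeΣ m = let (i , j) = enum ij m in codeΣ (a i) j
  Σ-∃ {suc k} a .correctΣ em α =
    (λ (i , x) → let (j , ¬c) = proj₁ (correctΣ (a i) em α) x in
      index ij (i , j) , ¬c ∘ subst (λ (i , j) → InΣ k (codeΣ (a i) j) α) (enum-index ij (i , j))) ,
    (λ (m , c) → let (i , j) = enum ij m in i , proj₂ (correctΣ (a i) em α) (j , c))

module _ {I : Set} (count : Countable I) {A : I → Cantor → Set} where

  Π-∀ : ∀ {k} → (∀ i → IsΠ k (A i)) → IsΠ k (λ α → ∀ i → A i α)
  Π-∀ a = Π-resp
    (λ em α → (λ h i → stable em λ ¬x → h (i , ¬x)) , (λ h (i , ¬x) → ¬x (h i)))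
    (Π-¬ (Σ-∃ count (λ i → Σ-¬ (a i))))

module _ {k : ℕ} {A B : Cantor → Set} where

  Σ-⊎ : IsΣ k A → IsΣ k B → IsΣ k (λ α → A α ⊎ B α)
  Σ-⊎ a b = Σ-resp
    (λ em α → (λ { (true , x) → inj₁ x ; (false , x) → inj₂ x }) , [ true ,_ , false ,_ ]′)
    (Σ-∃ Bool-countable {A = λ { true → A ; false → B }} λ { true → a ; false → b })

  Π-× : IsΠ k A → IsΠ k B → IsΠ k (λ α → A α × B α)
  Π-× a b = Π-resp
    (λ em α → (λ h → h true , h false) , (λ { (x , y) true → x ; (x , y) false → y }))
    (Π-∀ Bool-countable {A = λ { true → A ; false → B }} λ { true → a ; false → b })

-- Clopen subsets of Cantor space

record IsClopen (A : Cantor → Set) : Set where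
  field
    size : ℕ
    decide : ∀ α → Dec (A α)
    local : ∀ {α β} → (∀ i → i < size → α i ≡ β i) → A α → A β

open IsClopen

Clopen-const : {P : Set} → Dec P → IsClopen (λ _ → P)
Clopen-const P? .size = 0
Clopen-const P? .decide _ = P?
Clopen-const P? .local _ p = p

Clopen-bit : ∀ k b → IsClopen (λ α → α k ≡ b)
Clopen-bit k b .size = suc k
Clopen-bit k b .decide α = α k ≟ᵇ b
Clopen-bit k b .local agree eq = trans (sym (agree k ℕₚ.≤-refl)) eq

Clopen-¬ : ∀ {A} → IsClopen A → IsClopen (λ α → ¬ A α)
Clopen-¬ a .size = size a
Clopen-¬ a .decide α = ¬? (decide a α)
Clopen-¬ a .local agree ¬x x = ¬x (local a (λ i i<l → sym (agree i i<l)) x)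

Clopen-× : ∀ {A B} → IsClopen A → IsClopen B → IsClopen (λ α → A α × B α)
Clopen-× a b .size = size a ⊔ size b
Clopen-× a b .decide α = decide a α ×-dec decide b α
Clopen-× a b .local agree (x , y) =
  local a (λ i i<l → agree i (ℕₚ.m≤n⇒m≤n⊔o (size b) i<l)) x ,
  local b (λ i i<l → agree i (ℕₚ.m≤n⇒m≤o⊔n (size a) i<l)) y

Clopen-prefix : ∀ w → IsClopen (Prefix w)
Clopen-prefix [] = Clopen-const (yes tt)
Clopen-prefix (b ∷ w) .size = suc (size (Clopen-prefix w))
Clopen-prefix (b ∷ w) .decide α = (α 0 ≟ᵇ b) ×-dec decide (Clopen-prefix w) (α ∘ suc)
Clopen-prefix (b ∷ w) .local agree (eq , p) =
  trans (sym (agree 0 (s≤s z≤n))) eq , local (Clopen-prefix w) (λ i i<l → agree (suc i) (s≤s i<l)) p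

restrict : ℕ → Cantor → List Bool
restrict zero α = []
restrict (suc l) α = α 0 ∷ restrict l (α ∘ suc)

restrict-prefix : ∀ l α → Prefix (restrict l α) α
restrict-prefix zero α = tt
restrict-prefix (suc l) α = refl , restrict-prefix l (α ∘ suc)

length-restrict : ∀ l α → length (restrict l α) ≡ l
length-restrict zero α = refl
length-restrict (suc l) α = cong suc (length-restrict l (α ∘ suc))

pad : List Bool → Cantor
pad [] _ = false
pad (b ∷ w) zero = b
pad (b ∷ w) (suc i) = pad w i

pad-prefix : ∀ w {α} → Prefix w α → ∀ i → i < length w → pad w i ≡ α i
pad-prefix (b ∷ w) (eq , p) zero _ = sym eq
pad-prefix (b ∷ w) (eq , p) (suc i) (s≤s i<l) = pad-prefix w p i i<l

-- The first `size a` bits decide membership, so the accepted words of that length give cylinders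
-- with union `A`. `pad` turns a word into a point that can be tested.
Σ-clopen₀ : ∀ {A} → IsClopen A → IsΣ 0 A
Σ-clopen₀ {A} a = mkΣ (cylinder ∘ enum lists) λ em α → to , from
  where
  lists : Countable (List Bool)
  lists = List-countable Bool-countable
  accept : ∀ w → Dec (length w ≡ size a × A (pad w))
  accept w = (length w ℕₚ.≟ size a) ×-dec decide a (pad w)
  cylinder : List Bool → Maybe (List Bool)
  cylinder w with accept w
  ... | yes _ = just w
  ... | no _ = nothing
  cylinder-accept : ∀ w → length w ≡ size a × A (pad w) → cylinder w ≡ just w
  cylinder-accept w h with accept w
  ... | yes _ = refl
  ... | no ¬h = ⊥-elim (¬h h)
  accept-cylinder : ∀ w {v} → cylinder w ≡ just v → length v ≡ size a × A (pad v)
  accept-cylinder w eq with accept w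
  accept-cylinder w refl | yes h = h
  to : ∀ {α} → A α → InΣ 0 (cylinder ∘ enum lists) α
  to {α} x = index lists w , w , trans (cong cylinder (enum-index lists w)) (cylinder-accept w (l , x′)) , p
    where
    w = restrict (size a) α
    l = length-restrict (size a) α
    p = restrict-prefix (size a) α
    x′ : A (pad w)
    x′ = local a (λ i i<l → sym (pad-prefix w p i (subst (i <_) (sym l) i<l))) x
  from : ∀ {α} → InΣ 0 (cylinder ∘ enum lists) α → A α
  from (m , w , eq , p) with accept-cylinder (enum lists m) eq
  ... | l , x = local a (λ i i<l → pad-prefix w p i (subst (i <_) (sym l) i<l)) x

Clopen-cylinder : (c : Maybe (List Bool)) → IsClopen (λ α → ∃[ w ] (c ≡ just w × Prefix w α))
Clopen-cylinder nothing .size = 0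
Clopen-cylinder nothing .decide α = no λ ()
Clopen-cylinder nothing .local _ ()
Clopen-cylinder (just w) .size = size (Clopen-prefix w)
Clopen-cylinder (just w) .decide α with decide (Clopen-prefix w) α
... | yes p = yes (w , refl , p)
... | no ¬p = no λ { (_ , refl , p) → ¬p p }
Clopen-cylinder (just w) .local agree (_ , refl , p) = w , refl , local (Clopen-prefix w) agree p

-- Inclusions and finite closure properties of the classes

Σ-code : ∀ {k} (c : ΣCode k) → IsΣ k (InΣ k c)
Σ-code c = mkΣ c λ em α → id , id

-- A cylinder is clopen, so its complement is open and it is itself Π⁰₁; this starts the induction.
-- Higher up, each set under a complement is raised by one level.
Σ⇒Σ : ∀ {k A} → IsΣ k A → IsΣ (suc k) A
Σ⇒Σ {zero} a = Σ-resp (λ em α → proj₂ (correctΣ a em α) , proj₁ (correctΣ a em α))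
  (Σ-∃ ℕ-countable λ i → Π⇒Σ (Π-resp
    (λ em α → stable em , λ x ¬x → ¬x x)
    (Π-¬ (Σ-clopen₀ (Clopen-¬ (Clopen-cylinder (codeΣ a i)))))))
Σ⇒Σ {suc k} a = Σ-resp (λ em α → proj₂ (correctΣ a em α) , proj₁ (correctΣ a em α))
  (Σ-∃ ℕ-countable λ i → Π⇒Σ (Π-¬ (Σ⇒Σ (Σ-code (codeΣ a i)))))

-- Intersection distributes over the two unions. What remains is an intersection of two cylinders,
-- which is clopen, or of two complements, coded as the complement of a union.
Σ-× : ∀ {k A B} → IsΣ k A → IsΣ k B → IsΣ k (λ α → A α × B α)
Σ-× {zero} a b = Σ-resp
  (λ em α → (λ ((i , j) , x , y) → proj₂ (correctΣ a em α) (i , x) , proj₂ (correctΣ b em α) (j , y)) ,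
    (λ (x , y) → let (i , x′) = proj₁ (correctΣ a em α) x ; (j , y′) = proj₁ (correctΣ b em α) y in
      (i , j) , x′ , y′))
  (Σ-∃ (×-countable ℕ-countable ℕ-countable) λ (i , j) →
    Σ-clopen₀ (Clopen-× (Clopen-cylinder (codeΣ a i)) (Clopen-cylinder (codeΣ b j))))
Σ-× {suc k} a b = Σ-resp
  (λ em α → (λ ((i , j) , h) → proj₂ (correctΣ a em α) (i , h ∘ inj₁) , proj₂ (correctΣ b em α) (j , h ∘ inj₂)) ,
    (λ (x , y) → let (i , x′) = proj₁ (correctΣ a em α) x ; (j , y′) = proj₁ (correctΣ b em α) y in
      (i , j) , [ x′ , y′ ]′))
  (Σ-∃ (×-countable ℕ-countable ℕ-countable) λ (i , j) →
    Π⇒Σ (Π-¬ (Σ-⊎ (Σ-code (codeΣ a i)) (Σ-code (codeΣ b j)))))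

Σ-clopen : ∀ {k A} → IsClopen A → IsΣ k A
Σ-clopen {zero} a = Σ-clopen₀ a
Σ-clopen {suc k} a = Σ⇒Σ (Σ-clopen a)

Π-from-¬ : ∀ {k A} → IsΣ k (λ α → ¬ A α) → IsΠ k A
Π-from-¬ a = Π-resp (λ em α → stable em , λ x ¬x → ¬x x) (Π-¬ a)

Π⇒Π : ∀ {k A} → IsΠ k A → IsΠ (suc k) A
Π⇒Π a = Π-from-¬ (Σ⇒Σ (Σ-¬ a))

Π-→ : ∀ {k A B} → IsΣ k A → IsΠ k B → IsΠ k (λ α → A α → B α)
Π-→ a b = Π-resp
  (λ em α → (λ h x → stable em λ ¬y → h (x , ¬y)) , (λ h (x , ¬y) → ¬y (h x)))
  (Π-¬ (Σ-× a (Σ-¬ b)))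

-- De Morgan applied to `Σ-×`. The final union over cases thereby stays in the Π class.
Π-∃-finite : ∀ {k} {A : Bool → Cantor → Set} → (∀ b → IsΠ k (A b)) → IsΠ k (λ α → ∃[ b ] A b α)
Π-∃-finite a = Π-resp
  (λ em α → (λ h → stable em λ ¬x → h ((λ x → ¬x (true , x)) , (λ x → ¬x (false , x)))) ,
    (λ { (true , x) (¬x , _) → ¬x x ; (false , x) (_ , ¬x) → ¬x x }))
  (Π-¬ (Σ-× (Σ-¬ (a true)) (Σ-¬ (a false))))

-- Coordinates and walks on the hexagonal lattice

-- The point (r , s) stands for the tile d0 ± (s - r , r).

Pt : Set
Pt = ℤ × ℤ

rr ss : Pt → ℤ
rr = proj₁
ss = proj₂

⟦_⟧ : Bool → ℤ
⟦ true ⟧ = 1ℤ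
⟦ false ⟧ = 0ℤ

-- Steps are sorted by their effect on the row `s`, an antidiagonal of the quarter-plane: two keep
-- it, two raise it, two lower it.
data Dir : Set where
  flat up down : Bool → Dir

move : Dir → Pt → Pt
move (flat ε) (r , s) = (⟦ ε ⟧ - ⟦ not ε ⟧) +ℤ r , s
move (up ε) (r , s) = ⟦ ε ⟧ +ℤ r , 1ℤ +ℤ s
move (down ε) (r , s) = - ⟦ ε ⟧ +ℤ r , -1ℤ +ℤ s

data Walk (A : Pt → Set) : Pt → Pt → Set where
  stop : ∀ {t} → A t → Walk A t t
  go : ∀ {t u} → A t → (d : Dir) → Walk A (move d t) u → Walk A t u

walk-head : ∀ {A t u} → Walk A t u → A t
walk-head (stop a) = a
walk-head (go a _ _) = a

walk-last : ∀ {A t u} → Walk A t u → A u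
walk-last (stop a) = a
walk-last (go _ _ w) = walk-last w

-- Crossing parities

neg is0 le0 pos : ℤ → Bool
neg (+ _) = false
neg -[1+ _ ] = true
is0 (+ zero) = true
is0 (+ suc _) = false
is0 -[1+ _ ] = false
le0 (+ zero) = true
le0 (+ suc _) = false
le0 -[1+ _ ] = true
pos (+ zero) = false
pos (+ suc _) = true
pos -[1+ _ ] = false

neg-suc : ∀ a → a ≢ 0ℤ → 1ℤ +ℤ a ≢ 0ℤ → neg a ≡ neg (1ℤ +ℤ a)
neg-suc (+ _) _ _ = refl
neg-suc -[1+ zero ] _ h = ⊥-elim (h refl)
neg-suc -[1+ suc _ ] _ _ = refl

-- No sign change without passing through 0.
neg-near : ∀ ε ε′ {a a′} → a′ ≡ (a +ℤ ⟦ ε ⟧) - ⟦ ε′ ⟧ → a ≢ 0ℤ → a′ ≢ 0ℤ → neg a ≡ neg a′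
neg-near true true {a} refl h h′ = cong neg (sym (eq a))
  where eq : ∀ a → (a +ℤ 1ℤ) - 1ℤ ≡ a
        eq = solve-∀
neg-near false false {a} refl h h′ = cong neg (sym (eq a))
  where eq : ∀ a → (a +ℤ 0ℤ) - 0ℤ ≡ a
        eq = solve-∀
neg-near true false {a} refl h h′ = trans (neg-suc a h (λ e → h′ (trans (eq a) e))) (cong neg (sym (eq a)))
  where eq : ∀ a → (a +ℤ 1ℤ) - 0ℤ ≡ 1ℤ +ℤ a
        eq = solve-∀
neg-near false true {a} {a′} refl h h′ =
  sym (trans (neg-suc a′ h′ (λ e → h (trans (sym (eq a)) e))) (cong neg (eq a)))
  where eq : ∀ a → 1ℤ +ℤ ((a +ℤ 0ℤ) - 1ℤ) ≡ a
        eq = solve-∀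

-- l lies in the row of t, strictly to its right (r decreases from left to right).
rightOf : Pt → Pt → Bool
rightOf (r , s) (r′ , s′) = is0 (s - s′) ∧ neg (r - r′)

-- While the difference in `r` changes by at most one, two points of a common row can exchange their
-- order only by coinciding.
rightOf-near : ∀ ε ε′ l t l′ t′ → ss l′ - ss t′ ≡ ss l - ss t → rr l′ - rr t′ ≡ ((rr l - rr t) +ℤ ⟦ ε ⟧) - ⟦ ε′ ⟧ →
  l ≢ t → l′ ≢ t′ → rightOf l t ≡ rightOf l′ t′
rightOf-near ε ε′ (rl , sl) (rt , st) (rl′ , sl′) (rt′ , st′) seq req h h′ rewrite seq with sl - st in eq
... | + suc _ = refl
... | -[1+ _ ] = refl
... | + zero = neg-near ε ε′ req
  (λ e → h (cong₂ _,_ (ℤₚ.i-j≡0⇒i≡j rl rt e) (ℤₚ.i-j≡0⇒i≡j sl st eq)))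
  (λ e → h′ (cong₂ _,_ (ℤₚ.i-j≡0⇒i≡j rl′ rt′ e) (ℤₚ.i-j≡0⇒i≡j sl′ st′ seq)))

-- The step d from z crosses the ray from t to the right, slightly above its row.
stepR : Dir → Pt → Pt → Bool
stepR (flat _) z t = false
stepR (up _) z t = rightOf z t
stepR (down ε) z t = rightOf (move (down ε) z) t

-- The step d from t crosses the ray from z to the left, slightly below its row.
stepL : Dir → Pt → Pt → Bool
stepL (flat _) t z = false
stepL (up ε) t z = rightOf z (move (up ε) t)
stepL (down _) t z = rightOf z t

same⇒xor : ∀ {a b} → a ≡ b → false ≡ a xor b
same⇒xor {a} refl = sym (xor-same a)

-- Prolong the step from `t` by rays to the right at both ends, and the step from `z` by rays to the
-- left. The two curves meet evenly often. The steps do not cross each other, and the rays do not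
-- meet since one kind runs above its row and the other below; the remaining crossings of rays with
-- steps therefore cancel.
step-step : ∀ d z e t → z ≢ t → z ≢ move e t → move d z ≢ t → move d z ≢ move e t →
  stepR d z t xor stepR d z (move e t) ≡ stepL e t z xor stepL e t (move d z)
step-step (flat _) z (flat _) t _ _ _ _ = refl
step-step (flat ε) z@(a , b) (up η) t@(c , d) zt zt′ z′t z′t′ =
  same⇒xor (rightOf-near ε (not ε) z (move (up η) t) (move (flat ε) z) (move (up η) t)
    refl (eq a (⟦ η ⟧ +ℤ c) ⟦ ε ⟧ ⟦ not ε ⟧) zt′ z′t′)
  where eq : ∀ a c e f → ((e - f) +ℤ a) - c ≡ ((a - c) +ℤ e) - f
        eq = solve-∀
step-step (flat ε) z@(a , b) (down _) t@(c , d) zt zt′ z′t z′t′ =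
  same⇒xor (rightOf-near ε (not ε) z t (move (flat ε) z) t refl (eq a c ⟦ ε ⟧ ⟦ not ε ⟧) zt z′t)
  where eq : ∀ a c e f → ((e - f) +ℤ a) - c ≡ ((a - c) +ℤ e) - f
        eq = solve-∀
step-step (up η) z@(a , b) (flat ε) t@(c , d) zt zt′ z′t z′t′ =
  sym (same⇒xor (rightOf-near (not ε) ε z t z (move (flat ε) t) refl (eq a c ⟦ ε ⟧ ⟦ not ε ⟧) zt zt′))
  where eq : ∀ a c e f → a - ((e - f) +ℤ c) ≡ ((a - c) +ℤ f) - e
        eq = solve-∀
step-step (down η) z@(a , b) (flat ε) t@(c , d) zt zt′ z′t z′t′ =
  sym (same⇒xor (rightOf-near (not ε) ε z′ t z′ (move (flat ε) t) refl (eq (proj₁ z′) c ⟦ ε ⟧ ⟦ not ε ⟧) z′t z′t′))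
  where z′ = move (down η) z
        eq : ∀ a c e f → a - ((e - f) +ℤ c) ≡ ((a - c) +ℤ f) - e
        eq = solve-∀
step-step (up ε) z@(a , b) (up η) t@(c , d) zt zt′ z′t z′t′ =
  trans (cong (_xor rightOf z t′) (rightOf-near ε η z t z′ t′ (eqs b d) (eqr a c ⟦ ε ⟧ ⟦ η ⟧) zt z′t′))
    (xor-comm (rightOf z′ t′) (rightOf z t′))
  where z′ = move (up ε) z
        t′ = move (up η) t
        eqs : ∀ b d → (1ℤ +ℤ b) - (1ℤ +ℤ d) ≡ b - d
        eqs = solve-∀
        eqr : ∀ a c e f → (e +ℤ a) - (f +ℤ c) ≡ ((a - c) +ℤ e) - f
        eqr = solve-∀
step-step (up ε) z@(a , b) (down η) t@(c , d) zt zt′ z′t z′t′ =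
  cong (rightOf z t xor_) (rightOf-near ε η z t′ z′ t (eqs b d) (eqr a c ⟦ ε ⟧ ⟦ η ⟧) zt′ z′t)
  where z′ = move (up ε) z
        t′ = move (down η) t
        eqs : ∀ b d → (1ℤ +ℤ b) - d ≡ b - (-1ℤ +ℤ d)
        eqs = solve-∀
        eqr : ∀ a c e f → (e +ℤ a) - c ≡ ((a - (- f +ℤ c)) +ℤ e) - f
        eqr = solve-∀
step-step (down ε) z@(a , b) (up η) t@(c , d) zt zt′ z′t z′t′ =
  cong (_xor rightOf z′ t′) (rightOf-near ε η z′ t z t′ (eqs b d) (eqr a c ⟦ ε ⟧ ⟦ η ⟧) z′t zt′)
  where z′ = move (down ε) z
        t′ = move (up η) t
        eqs : ∀ b d → b - (1ℤ +ℤ d) ≡ (-1ℤ +ℤ b) - d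
        eqs = solve-∀
        eqr : ∀ a c e f → a - (f +ℤ c) ≡ (((- e +ℤ a) - c) +ℤ e) - f
        eqr = solve-∀
step-step (down ε) z@(a , b) (down η) t@(c , d) zt zt′ z′t z′t′ =
  trans (xor-comm (rightOf z′ t) (rightOf z′ t′))
    (cong (_xor rightOf z′ t) (rightOf-near ε η z′ t′ z t (eqs b d) (eqr a c ⟦ ε ⟧ ⟦ η ⟧) z′t′ zt))
  where z′ = move (down ε) z
        t′ = move (down η) t
        eqs : ∀ b d → b - d ≡ (-1ℤ +ℤ b) - (-1ℤ +ℤ d)
        eqs = solve-∀
        eqr : ∀ a c e f → a - c ≡ (((- e +ℤ a) - (- f +ℤ c)) +ℤ e) - f
        eqr = solve-∀

walkR : ∀ {A t u} → Walk A t u → Pt → Bool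
walkR (stop _) p = false
walkR (go {t} _ d w) p = stepR d t p xor walkR w p

walkL : ∀ {A t u} → Walk A t u → Pt → Bool
walkL (stop _) p = false
walkL (go {t} _ d w) p = stepL d t p xor walkL w p

xor-interchange : ∀ a b c d → (a xor b) xor (c xor d) ≡ (a xor c) xor (b xor d)
xor-interchange = interchange (CommutativeRing.+-commutativeSemigroup xor-∧-commutativeRing)

xor-telescope : ∀ a b c → (a xor b) xor (b xor c) ≡ a xor c
xor-telescope false false c = refl
xor-telescope false true false = refl
xor-telescope false true true = refl
xor-telescope true false c = refl
xor-telescope true true false = refl
xor-telescope true true true = refl

telescope : ∀ a a′ b b′ c d e → a xor b ≡ c xor d → a′ xor b′ ≡ d xor e → (a xor a′) xor (b xor b′) ≡ c xor e
telescope a a′ b b′ c d e p q =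
  trans (xor-interchange a a′ b b′) (trans (cong₂ _xor_ p q) (xor-telescope c d e))

module _ {A C : Pt → Set} (disjoint : ∀ {t} → A t → C t → ⊥) where

  private
    apart : ∀ {z t} → A t → C z → z ≢ t
    apart a c refl = disjoint a c

  step-walk : ∀ {q f} (Z : Walk C q f) e t → A t → A (move e t) →
    walkR Z t xor walkR Z (move e t) ≡ stepL e t q xor stepL e t f
  step-walk {q} (stop c) e t a a′ = sym (xor-same (stepL e t q))
  step-walk {q} {f} (go c d Z) e t a a′ = telescope
    (stepR d q t) (walkR Z t) (stepR d q (move e t)) (walkR Z (move e t)) (stepL e t q) (stepL e t (move d q)) (stepL e t f)
    (step-step d q e t (apart a c) (apart a′ c) (apart a (walk-head Z)) (apart a′ (walk-head Z)))
    (step-walk Z e t a a′)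

  -- `step-step` is summed over all pairs of steps; rays from inner points of the walks occur twice
  -- and cancel.
  walk-walk : ∀ {p g q f} (Γ : Walk A p g) (Z : Walk C q f) →
    walkL Γ q xor walkL Γ f ≡ walkR Z p xor walkR Z g
  walk-walk {p} (stop a) Z = sym (xor-same (walkR Z p))
  walk-walk {p} {g} {q} {f} (go a e Γ) Z = telescope
    (stepL e p q) (walkL Γ q) (stepL e p f) (walkL Γ f) (walkR Z p) (walkR Z (move e p)) (walkR Z g)
    (sym (step-walk Z e p a (walk-head Γ))) (walk-walk Γ Z)

walkR-zero : ∀ {A q f} g (Z : Walk A q f) → (∀ {t} → A t → rightOf t g ≡ false) → walkR Z g ≡ false
walkR-zero g (stop _) h = refl
walkR-zero g (go a (flat _) Z) h = walkR-zero g Z h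
walkR-zero g (go a (up _) Z) h rewrite h a = walkR-zero g Z h
walkR-zero g (go a (down _) Z) h rewrite h (walk-head Z) = walkR-zero g Z h

walkL-zero : ∀ {A p g} f (Γ : Walk A p g) → (∀ {t} → A t → rightOf f t ≡ false) → walkL Γ f ≡ false
walkL-zero f (stop _) h = refl
walkL-zero f (go a (flat _) Γ) h = walkL-zero f Γ h
walkL-zero f (go a (up _) Γ) h rewrite h (walk-head Γ) = walkL-zero f Γ h
walkL-zero f (go a (down _) Γ) h rewrite h a = walkL-zero f Γ h

-- Descending curves: the ray r = const (side V) and the ray s - r = const (side H).

data Side : Set where
  V H : Side

κ : Side → Pt → ℤ
κ V (r , s) = r
κ H (r , s) = r - s

slope : Side → Bool
slope V = false
slope H = true

κ-flat : ∀ i ε t → κ i (move (flat ε) t) ≡ (κ i t +ℤ ⟦ ε ⟧) - ⟦ not ε ⟧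
κ-flat V ε (r , s) = eq r ⟦ ε ⟧ ⟦ not ε ⟧
  where eq : ∀ r e f → (e - f) +ℤ r ≡ (r +ℤ e) - f
        eq = solve-∀
κ-flat H ε (r , s) = eq r s ⟦ ε ⟧ ⟦ not ε ⟧
  where eq : ∀ r s e f → ((e - f) +ℤ r) - s ≡ ((r - s) +ℤ e) - f
        eq = solve-∀

κ-up : ∀ i ε t → κ i (move (up ε) t) ≡ (κ i t +ℤ ⟦ ε ⟧) - ⟦ slope i ⟧
κ-up V ε (r , s) = eq r ⟦ ε ⟧
  where eq : ∀ r e → e +ℤ r ≡ (r +ℤ e) - 0ℤ
        eq = solve-∀
κ-up H ε (r , s) = eq r s ⟦ ε ⟧
  where eq : ∀ r s e → (e +ℤ r) - (1ℤ +ℤ s) ≡ ((r - s) +ℤ e) - 1ℤ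
        eq = solve-∀

up-down : ∀ ε t → move (up ε) (move (down ε) t) ≡ t
up-down ε (r , s) = cong₂ _,_ (eq ⟦ ε ⟧ r) (eq 1ℤ s)
  where eq : ∀ e r → e +ℤ (- e +ℤ r) ≡ r
        eq = solve-∀

rightOf-κ : ∀ i l t → rightOf l t ≡ is0 (ss l - ss t) ∧ neg (κ i l - κ i t)
rightOf-κ V l t = refl
rightOf-κ H (a , b) (c , d) with b - d in e
... | + suc _ = refl
... | -[1+ _ ] = refl
... | + zero = cong neg (trans (eq a b c d) (trans (cong (λ x → ((a - b) - (c - d)) +ℤ x) e) (ℤₚ.+-identityʳ _)))
  where eq : ∀ a b c d → a - c ≡ ((a - b) - (c - d)) +ℤ (b - d)
        eq = solve-∀

-- z lies to the right of the curve descending from p.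
curveL : Side → Pt → Pt → Bool
curveL i p z = le0 (ss z - ss p) ∧ neg (κ i z - κ i p)

-- t lies to the left of the curve descending from q, and below q.
curveR : Side → Pt → Pt → Bool
curveR i q t = pos (ss q - ss t) ∧ neg (κ i q - κ i t)

OffCurve : Side → Pt → Pt → Set
OffCurve i p t = κ i t ≡ κ i p → ¬ ss t ≤ℤ ss p

le0⇒≤ : ∀ x y → le0 (x - y) ≡ true → x ≤ℤ y
le0⇒≤ x y h with x - y in e
... | + zero = ℤₚ.≤-reflexive (ℤₚ.i-j≡0⇒i≡j x y e)
... | -[1+ _ ] = ℤₚ.i-j≤0⇒i≤j (subst (_≤ℤ 0ℤ) (sym e) -≤+)

nonneg⇒≤ : ∀ x y → neg (x - y) ≡ false → y ≤ℤ x
nonneg⇒≤ x y h with x - y in e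
... | + _ = ℤₚ.0≤i-j⇒j≤i (subst (0ℤ ≤ℤ_) (sym e) (+≤+ Data.Nat.z≤n))

curveL-core : ∀ b ε ε′ {a a′} → a′ ≡ (a +ℤ ⟦ ε ⟧) - ⟦ ε′ ⟧ →
  (a ≡ 0ℤ → le0 b ≢ true) → (a′ ≡ 0ℤ → le0 (1ℤ +ℤ b) ≢ true) →
  is0 b ∧ neg a ≡ (le0 b ∧ neg a) xor (le0 (1ℤ +ℤ b) ∧ neg a′)
curveL-core (+ zero) ε ε′ {a} eq h h′ = sym (xor-identityʳ (neg a))
curveL-core (+ suc _) ε ε′ eq h h′ = refl
curveL-core -[1+ zero ] ε ε′ eq h h′ = same⇒xor (neg-near ε ε′ eq (λ e → h e refl) (λ e → h′ e refl))
curveL-core -[1+ suc _ ] ε ε′ eq h h′ = same⇒xor (neg-near ε ε′ eq (λ e → h e refl) (λ e → h′ e refl))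

curveR-core : ∀ b′ ε ε′ {a a′} → a′ ≡ (a +ℤ ⟦ ε ⟧) - ⟦ ε′ ⟧ →
  (a ≡ 0ℤ → neg (1ℤ +ℤ b′) ≢ false) → (a′ ≡ 0ℤ → neg b′ ≢ false) →
  is0 b′ ∧ neg a′ ≡ (pos (1ℤ +ℤ b′) ∧ neg a) xor (pos b′ ∧ neg a′)
curveR-core (+ zero) ε ε′ {a} eq h h′ =
  trans (sym (neg-near ε ε′ eq (λ e → h e refl) (λ e → h′ e refl))) (sym (xor-identityʳ (neg a)))
curveR-core (+ suc _) ε ε′ eq h h′ = same⇒xor (neg-near ε ε′ eq (λ e → h e refl) (λ e → h′ e refl))
curveR-core -[1+ zero ] ε ε′ eq h h′ = refl
curveR-core -[1+ suc _ ] ε ε′ eq h h′ = refl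

off⇒L : ∀ i p t → OffCurve i p t → κ i t - κ i p ≡ 0ℤ → le0 (ss t - ss p) ≢ true
off⇒L i p t off e h = off (ℤₚ.i-j≡0⇒i≡j _ _ e) (le0⇒≤ _ _ h)

off⇒R : ∀ i p t → OffCurve i p t → κ i p - κ i t ≡ 0ℤ → neg (ss p - ss t) ≢ false
off⇒R i p t off e h = off (sym (ℤₚ.i-j≡0⇒i≡j _ _ e)) (nonneg⇒≤ _ _ h)

-- The ray from `p` to the right and the curve descending from `p` bound the region with indicator
-- `curveL i p`. A step that avoids the curve enters or leaves it through the ray only. The row of
-- `p` counts as inside, because the ray runs above it.
curveL-step : ∀ i p d z → OffCurve i p z → OffCurve i p (move d z) →
  stepR d z p ≡ curveL i p z xor curveL i p (move d z)
curveL-step i p (flat ε) z off off′ with le0 (ss z - ss p) in e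
... | false = refl
... | true = same⇒xor (neg-near ε (not ε) (trans (cong (_- κ i p) (κ-flat i ε z)) (eq (κ i z) (κ i p) ⟦ ε ⟧ ⟦ not ε ⟧))
    (λ h → off⇒L i p z off h e) (λ h → off⇒L i p (move (flat ε) z) off′ h e))
  where eq : ∀ a c e f → ((a +ℤ e) - f) - c ≡ ((a - c) +ℤ e) - f
        eq = solve-∀
curveL-step i p (up ε) z off off′ = begin
  rightOf z p ≡⟨ rightOf-κ i z p ⟩
  is0 b ∧ neg a ≡⟨ curveL-core b ε (slope i)
    (trans (cong (_- κ i p) (κ-up i ε z)) (eq (κ i z) (κ i p) ⟦ ε ⟧ ⟦ slope i ⟧))
    (off⇒L i p z off) (λ h → subst (λ x → le0 x ≢ true) (eqs (ss z) (ss p)) (off⇒L i p (move (up ε) z) off′ h)) ⟩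
  curveL i p z xor (le0 (1ℤ +ℤ b) ∧ neg a′) ≡⟨ cong (λ x → curveL i p z xor (le0 x ∧ neg a′)) (sym (eqs (ss z) (ss p))) ⟩
  curveL i p z xor curveL i p (move (up ε) z) ∎
  where
  open ≡-Reasoning
  a a′ b : ℤ
  a = κ i z - κ i p
  a′ = κ i (move (up ε) z) - κ i p
  b = ss z - ss p
  eq : ∀ a c e f → ((a +ℤ e) - f) - c ≡ ((a - c) +ℤ e) - f
  eq = solve-∀
  eqs : ∀ x y → (1ℤ +ℤ x) - y ≡ 1ℤ +ℤ (x - y)
  eqs = solve-∀
curveL-step i p (down ε) z off off′ = begin
  rightOf z′ p ≡⟨ curveL-step i p (up ε) z′ off′ (subst (OffCurve i p) (sym (up-down ε z)) off) ⟩
  curveL i p z′ xor curveL i p (move (up ε) z′) ≡⟨ cong (λ x → curveL i p z′ xor curveL i p x) (up-down ε z) ⟩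
  curveL i p z′ xor curveL i p z ≡⟨ xor-comm (curveL i p z′) (curveL i p z) ⟩
  curveL i p z xor curveL i p z′ ∎
  where
  open ≡-Reasoning
  z′ : Pt
  z′ = move (down ε) z

-- The mirror image of `curveL-step`. Here the ray runs below the row of `q`, so that row is outside
-- the region: hence `pos` in place of `le0`.
curveR-step : ∀ i q d t → OffCurve i q t → OffCurve i q (move d t) →
  stepL d t q ≡ curveR i q t xor curveR i q (move d t)
curveR-step i q (flat ε) t off off′ with pos (ss q - ss t) in e
... | false = refl
... | true = same⇒xor (neg-near (not ε) ε (trans (cong (λ x → κ i q - x) (κ-flat i ε t)) (eq (κ i t) (κ i q) ⟦ ε ⟧ ⟦ not ε ⟧))
    (λ h → off⇒R i q t off h (pos⇒nonneg _ e)) (λ h → off⇒R i q (move (flat ε) t) off′ h (pos⇒nonneg _ e)))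
  where eq : ∀ a c e f → c - ((a +ℤ e) - f) ≡ ((c - a) +ℤ f) - e
        eq = solve-∀
        pos⇒nonneg : ∀ x → pos x ≡ true → neg x ≡ false
        pos⇒nonneg (+ _) _ = refl
curveR-step i q (up ε) t off off′ = begin
  rightOf q t′ ≡⟨ rightOf-κ i q t′ ⟩
  is0 b′ ∧ neg a′ ≡⟨ curveR-core b′ (slope i) ε
    (trans (cong (λ x → κ i q - x) (κ-up i ε t)) (eq (κ i t) (κ i q) ⟦ ε ⟧ ⟦ slope i ⟧))
    (λ h → subst (λ x → neg x ≢ false) (eqs (ss q) (ss t)) (off⇒R i q t off h)) (off⇒R i q t′ off′) ⟩
  (pos (1ℤ +ℤ b′) ∧ neg a) xor curveR i q t′ ≡⟨ cong (λ x → (pos x ∧ neg a) xor curveR i q t′) (sym (eqs (ss q) (ss t))) ⟩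
  curveR i q t xor curveR i q t′ ∎
  where
  open ≡-Reasoning
  t′ : Pt
  t′ = move (up ε) t
  a a′ b′ : ℤ
  a = κ i q - κ i t
  a′ = κ i q - κ i t′
  b′ = ss q - ss t′
  eq : ∀ a c e f → c - ((a +ℤ e) - f) ≡ ((c - a) +ℤ f) - e
  eq = solve-∀
  eqs : ∀ x y → x - y ≡ 1ℤ +ℤ (x - (1ℤ +ℤ y))
  eqs = solve-∀
curveR-step i q (down ε) t off off′ = begin
  rightOf q t ≡⟨ cong (rightOf q) (sym (up-down ε t)) ⟩
  rightOf q (move (up ε) t′) ≡⟨ curveR-step i q (up ε) t′ off′ (subst (OffCurve i q) (sym (up-down ε t)) off) ⟩
  curveR i q t′ xor curveR i q (move (up ε) t′) ≡⟨ cong (λ x → curveR i q t′ xor curveR i q x) (up-down ε t) ⟩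
  curveR i q t′ xor curveR i q t ≡⟨ xor-comm (curveR i q t′) (curveR i q t) ⟩
  curveR i q t xor curveR i q t′ ∎
  where
  open ≡-Reasoning
  t′ : Pt
  t′ = move (down ε) t

curveL-walk : ∀ {A q f} i p (Z : Walk A q f) → (∀ {t} → A t → OffCurve i p t) →
  walkR Z p ≡ curveL i p q xor curveL i p f
curveL-walk {q = q} i p (stop a) off = sym (xor-same (curveL i p q))
curveL-walk {q = q} {f} i p (go a d Z) off =
  trans (cong₂ _xor_ (curveL-step i p d q (off a) (off (walk-head Z))) (curveL-walk i p Z off))
    (xor-telescope (curveL i p q) (curveL i p (move d q)) (curveL i p f))

curveR-walk : ∀ {A p g} i q (Γ : Walk A p g) → (∀ {t} → A t → OffCurve i q t) →
  walkL Γ q ≡ curveR i q p xor curveR i q g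
curveR-walk {p = p} i q (stop a) off = sym (xor-same (curveR i q p))
curveR-walk {p = p} {g} i q (go a d Γ) off =
  trans (cong₂ _xor_ (curveR-step i q d p (off a) (off (walk-head Γ))) (curveR-walk i q Γ off))
    (xor-telescope (curveR i q p) (curveR i q (move d p)) (curveR i q g))

-- The curve descending from p passes to the left of the one descending from q.
leftOf : Side → Pt → Side → Pt → Bool
leftOf i p j q = curveL i p q xor curveR j q p

le0-< : ∀ x y → y <ℤ x → le0 (x - y) ≡ false
le0-< x y y<x with le0 (x - y) in e
... | false = refl
... | true = ⊥-elim (ℤₚ.<⇒≱ y<x (le0⇒≤ x y e))

pos-≤ : ∀ x y → x ≤ℤ y → pos (x - y) ≡ false
pos-≤ x y x≤y with x - y in e
... | + zero = refl
... | -[1+ _ ] = refl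
... | + suc _ with subst (_≤ℤ 0ℤ) e (ℤₚ.i≤j⇒i-j≤0 x≤y)
...   | +≤+ ()

-- Two disjoint walks, prolonged by the curves descending from their starting points and by
-- half-rows from their end points, cannot cross.
crossing : ∀ {A C p g q f} i j → (∀ {t} → A t → C t → ⊥) → (Γ : Walk A p g) (Z : Walk C q f) →
  (∀ {t} → C t → OffCurve i p t) → (∀ {t} → A t → OffCurve j q t) →
  (∀ {t} → C t → rightOf t g ≡ false) → (∀ {t} → A t → rightOf f t ≡ false) →
  ss p <ℤ ss f → ss q ≤ℤ ss g → leftOf i p j q ≡ false
crossing {p = p} {g} {q} {f} i j disjoint Γ Z offp offq Cg Af p<f q≤g = begin
  curveL i p q xor curveR j q p ≡⟨ cong₂ _xor_ (sym eqR) (sym eqL) ⟩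
  walkR Z p xor walkL Γ q ≡⟨ cong₂ _xor_ (sym (xor-identityʳ (walkR Z p))) (sym (xor-identityʳ (walkL Γ q))) ⟩
  (walkR Z p xor false) xor (walkL Γ q xor false) ≡⟨ cong₂ _xor_
    (cong (walkR Z p xor_) (sym (walkR-zero g Z Cg))) (cong (walkL Γ q xor_) (sym (walkL-zero f Γ Af))) ⟩
  (walkR Z p xor walkR Z g) xor (walkL Γ q xor walkL Γ f) ≡⟨ sym (same⇒xor (sym (walk-walk disjoint Γ Z))) ⟩
  false ∎
  where
  open ≡-Reasoning
  -- `f` lies above `p`, hence outside the region of `curveL i p`, so only `q` contributes.
  eqR : walkR Z p ≡ curveL i p q
  eqR = trans (curveL-walk i p Z offp)
    (trans (cong (λ x → curveL i p q xor (x ∧ neg (κ i f - κ i p))) (le0-< (ss f) (ss p) p<f)) (xor-identityʳ _))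
  eqL : walkL Γ q ≡ curveR j q p
  eqL = trans (curveR-walk j q Γ offq)
    (trans (cong (λ x → curveR j q p xor (x ∧ neg (κ j q - κ j g))) (pos-≤ (ss q) (ss g) q≤g)) (xor-identityʳ _))

neg-antisym : ∀ a → a ≢ 0ℤ → neg a xor neg (- a) ≡ true
neg-antisym (+ zero) h = ⊥-elim (h refl)
neg-antisym (+ suc _) _ = refl
neg-antisym -[1+ _ ] _ = refl

leftOf-core : ∀ x a b → (le0 x ≡ true → a ≢ 0ℤ) → (neg x ≡ false → b ≢ 0ℤ) → (x ≡ 0ℤ → b ≡ - a) →
  ((le0 x ∧ neg a) xor (pos x ∧ neg (- b))) xor ((le0 (- x) ∧ neg b) xor (pos (- x) ∧ neg (- a))) ≡ true
leftOf-core (+ zero) a b ha hb h0 with h0 refl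
... | refl rewrite xor-identityʳ (neg a) | xor-identityʳ (neg (- a)) = neg-antisym a (ha refl)
leftOf-core (+ suc _) a b ha hb h0 rewrite xor-identityʳ (neg b) =
  trans (xor-comm (neg (- b)) (neg b)) (neg-antisym b (hb refl))
leftOf-core -[1+ _ ] a b ha hb h0 rewrite xor-identityʳ (neg a) = neg-antisym a (ha refl)

κ-row : ∀ i p q → ss p ≡ ss q → κ i p - κ i q ≡ rr p - rr q
κ-row V p q e = refl
κ-row H (r , s) (r′ , s) refl = eq r r′ s
  where eq : ∀ r r′ s → (r - s) - (r′ - s) ≡ r - r′
        eq = solve-∀

sub-flip : ∀ x y → x - y ≡ - (y - x)
sub-flip = solve-∀

-- Both orders compare the lower starting point with the curve of the higher one, with opposite
-- signs. In a common row either side gives the difference in `r`, so mixed sides agree there.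
leftOf-total : ∀ i p j q → OffCurve i p q → OffCurve j q p → leftOf i p j q xor leftOf j q i p ≡ true
leftOf-total i p j q off off′ = begin
  (curveL i p q xor curveR j q p) xor (curveL j q p xor curveR i p q) ≡⟨ cong₂ _xor_
    (cong (λ y → curveL i p q xor (pos x ∧ neg y)) (sub-flip (κ j q) (κ j p)))
    (cong₂ (λ x y → (le0 x ∧ neg b) xor (pos x ∧ neg y)) (sub-flip (ss p) (ss q)) (sub-flip (κ i p) (κ i q))) ⟩
  ((le0 x ∧ neg a) xor (pos x ∧ neg (- b))) xor ((le0 (- x) ∧ neg b) xor (pos (- x) ∧ neg (- a))) ≡⟨ leftOf-core x a b
    (λ h e → off⇒L i p q off e h) (λ h e → off⇒R j q p off′ (trans (sub-flip (κ j q) (κ j p)) (cong -_ e)) h)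
    (λ e → let row = ℤₚ.i-j≡0⇒i≡j (ss q) (ss p) e in
      trans (κ-row j p q (sym row)) (trans (sub-flip (rr p) (rr q)) (cong -_ (sym (κ-row i q p row))))) ⟩
  true ∎
  where
  open ≡-Reasoning
  x a b : ℤ
  x = ss q - ss p
  a = κ i q - κ i p
  b = κ j p - κ j q

-- Linear arithmetic: inequalities are kept in the form 0 ≤ x and added up.

gap : ∀ {a b} → a ≤ℤ b → 0ℤ ≤ℤ b - a
gap = ℤₚ.i≤j⇒0≤j-i

infixl 6 _⊕_
_⊕_ : ∀ {x y} → 0ℤ ≤ℤ x → 0ℤ ≤ℤ y → 0ℤ ≤ℤ x +ℤ y
_⊕_ = ℤₚ.+-mono-≤

abstract
  by-gap : ∀ {a b x} → x ≡ b - a → 0ℤ ≤ℤ x → a ≤ℤ b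
  by-gap refl h = ℤₚ.0≤i-j⇒j≤i h

  absurd-gap : ∀ {x k} → x ≡ -[1+ k ] → 0ℤ ≤ℤ x → ⊥
  absurd-gap refl ()

≰⇒1+≤ : ∀ {a b} → ¬ a ≤ℤ b → 1ℤ +ℤ b ≤ℤ a
≰⇒1+≤ h = ℤₚ.i<j⇒suc[i]≤j (ℤₚ.≰⇒> h)

i≤+∣i∣ : ∀ i → i ≤ℤ + ∣ i ∣
i≤+∣i∣ (+ _) = ℤₚ.≤-refl
i≤+∣i∣ -[1+ _ ] = -≤+

-- Walks

walk-map : ∀ {A C t u} → (∀ {v} → A v → C v) → Walk A t u → Walk C t u
walk-map f (stop a) = stop (f a)
walk-map f (go a d w) = go (f a) d (walk-map f w)

infixr 5 _++_
_++_ : ∀ {A t u v} → Walk A t u → Walk A u v → Walk A t v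
stop _ ++ w′ = w′
go a d w ++ w′ = go a d (w ++ w′)

back : Dir → Dir
back (flat ε) = flat (not ε)
back (up ε) = down ε
back (down ε) = up ε

move-back : ∀ d t → move (back d) (move d t) ≡ t
move-back (flat true) (r , s) = cong (_, s) (eq r)
  where eq : ∀ r → (0ℤ - 1ℤ) +ℤ ((1ℤ - 0ℤ) +ℤ r) ≡ r
        eq = solve-∀
move-back (flat false) (r , s) = cong (_, s) (eq r)
  where eq : ∀ r → (1ℤ - 0ℤ) +ℤ ((0ℤ - 1ℤ) +ℤ r) ≡ r
        eq = solve-∀
move-back (up ε) (r , s) = cong₂ _,_ (eq ⟦ ε ⟧ r) (eq 1ℤ s)
  where eq : ∀ e r → - e +ℤ (e +ℤ r) ≡ r
        eq = solve-∀
move-back (down ε) t = up-down ε t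

step-back : ∀ {A t} d → A t → A (move d t) → Walk A (move d t) t
step-back {A} {t} d a a′ = go a′ (back d) (subst (λ u → Walk A u t) (sym (move-back d t)) (stop a))

reverse : ∀ {A t u} → Walk A t u → Walk A u t
reverse (stop a) = stop a
reverse (go a d w) = reverse w ++ step-back d a (walk-head w)

walk-bound : ∀ {A t u} → Walk A t u → ∃[ K ] Walk (λ v → A v × ss v ≤ℤ + K) t u
walk-bound {t = t} (stop a) = ∣ ss t ∣ , stop (a , i≤+∣i∣ (ss t))
walk-bound {t = t} (go a d w) with walk-bound w
... | K , w′ = ∣ ss t ∣ ⊔ K ,
  go (a , ℤₚ.≤-trans (i≤+∣i∣ (ss t)) (+≤+ (ℕₚ.m≤m⊔n ∣ ss t ∣ K))) d
    (walk-map (λ (a , h) → a , ℤₚ.≤-trans h (+≤+ (ℕₚ.m≤n⊔m ∣ ss t ∣ K))) w′)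

-- Each point records that it lies in the component of `p`, so that disjointness of components can
-- be used point by point.
walk-reach : ∀ {A D : Pt → Set} {p t u} → Walk A p t → Walk (λ v → A v × D v) t u → Walk (λ v → Walk A p v × D v) t u
walk-reach acc (stop (a , d)) = stop (acc , d)
walk-reach acc (go (a , d) e w) = go (acc , d) e (walk-reach (acc ++ go a e (stop (proj₁ (walk-head w)))) w)

-- Quarter-planes

coord : Side → Pt → ℤ
coord V (r , s) = s - r
coord H (r , s) = s +ℤ r

Q : ℕ → Pt → Set
Q n t = ∀ i → + n ≤ℤ coord i t

Q-mono : ∀ {m n} t → m ≤ n → Q n t → Q m t
Q-mono t m≤n h i = ℤₚ.≤-trans (+≤+ m≤n) (h i)

Q? : ∀ n t → Dec (Q n t)
Q? n t with + n ℤₚ.≤? coord V t | + n ℤₚ.≤? coord H t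
... | yes v | yes h = yes λ { V → v ; H → h }
... | no ¬v | _ = no λ q → ¬v (q V)
... | _ | no ¬h = no λ q → ¬h (q H)

¬Q⇒coord : ∀ n t → ¬ Q n t → ∃[ i ] (1ℤ +ℤ coord i t ≤ℤ + n)
¬Q⇒coord n t ¬q with + n ℤₚ.≤? coord V t | + n ℤₚ.≤? coord H t
... | yes v | yes h = ⊥-elim (¬q λ { V → v ; H → h })
... | no ¬v | _ = V , ≰⇒1+≤ ¬v
... | _ | no ¬h = H , ≰⇒1+≤ ¬h

-- The curve of side `i` lowers `coord i` by `width i +ℤ 1ℤ` at every step. By `coord-move` this is
-- also the largest drop that any step can cause.
width : Side → ℤ
width V = 0ℤ
width H = 1ℤ

-- The points of Q n from which the curve of side i leaves Q n at once.
Exit : Side → ℕ → Pt → Set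
Exit i n p = Q n p × coord i p ≤ℤ + n +ℤ width i

⟦⟧-nonneg : ∀ ε → 0ℤ ≤ℤ ⟦ ε ⟧
⟦⟧-nonneg true = +≤+ z≤n
⟦⟧-nonneg false = +≤+ z≤n

⟦⟧-≤1 : ∀ ε → ⟦ ε ⟧ ≤ℤ 1ℤ
⟦⟧-≤1 true = +≤+ (s≤s z≤n)
⟦⟧-≤1 false = +≤+ z≤n

0≤ : ∀ k → 0ℤ ≤ℤ + k
0≤ k = +≤+ z≤n

coord-move : ∀ i d t → coord i t ≤ℤ (coord i (move d t) +ℤ width i) +ℤ 1ℤ
coord-move V (flat ε) (r , s) = by-gap (eq r s ⟦ ε ⟧ ⟦ not ε ⟧) (gap (⟦⟧-≤1 ε) ⊕ ⟦⟧-nonneg (not ε))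
  where eq : ∀ r s e f → (1ℤ - e) +ℤ f ≡ (((s - ((e - f) +ℤ r)) +ℤ 0ℤ) +ℤ 1ℤ) - (s - r)
        eq = solve-∀
coord-move V (up ε) (r , s) = by-gap (eq r s ⟦ ε ⟧) (gap (⟦⟧-≤1 ε) ⊕ 0≤ 1)
  where eq : ∀ r s e → (1ℤ - e) +ℤ 1ℤ ≡ ((((1ℤ +ℤ s) - (e +ℤ r)) +ℤ 0ℤ) +ℤ 1ℤ) - (s - r)
        eq = solve-∀
coord-move V (down ε) (r , s) = by-gap (eq r s ⟦ ε ⟧) (⟦⟧-nonneg ε)
  where eq : ∀ r s e → e ≡ ((((-1ℤ +ℤ s) - (- e +ℤ r)) +ℤ 0ℤ) +ℤ 1ℤ) - (s - r)
        eq = solve-∀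
coord-move H (flat ε) (r , s) = by-gap (eq r s ⟦ ε ⟧ ⟦ not ε ⟧) (⟦⟧-nonneg ε ⊕ gap (⟦⟧-≤1 (not ε)) ⊕ 0≤ 1)
  where eq : ∀ r s e f → (e +ℤ (1ℤ - f)) +ℤ 1ℤ ≡ (((s +ℤ ((e - f) +ℤ r)) +ℤ 1ℤ) +ℤ 1ℤ) - (s +ℤ r)
        eq = solve-∀
coord-move H (up ε) (r , s) = by-gap (eq r s ⟦ ε ⟧) (⟦⟧-nonneg ε ⊕ 0≤ 3)
  where eq : ∀ r s e → e +ℤ + 3 ≡ ((((1ℤ +ℤ s) +ℤ (e +ℤ r)) +ℤ 1ℤ) +ℤ 1ℤ) - (s +ℤ r)
        eq = solve-∀
coord-move H (down ε) (r , s) = by-gap (eq r s ⟦ ε ⟧) (gap (⟦⟧-≤1 ε))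
  where eq : ∀ r s e → 1ℤ - e ≡ ((((-1ℤ +ℤ s) +ℤ (- e +ℤ r)) +ℤ 1ℤ) +ℤ 1ℤ) - (s +ℤ r)
        eq = solve-∀

κ-injective : ∀ i p t → κ i t ≡ κ i p → ss t ≡ ss p → t ≡ p
κ-injective V (r , s) (r′ , s′) refl refl = refl
κ-injective H (r , s) (r′ , s′) e refl =
  cong (_, s) (ℤₚ.i-j≡0⇒i≡j r′ r (trans (sym (κ-row H (r′ , s) (r , s) refl)) (ℤₚ.i≡j⇒i-j≡0 e)))

exit-eqV : ∀ r r′ s s′ n → (((s - (1ℤ +ℤ s′)) +ℤ ((n +ℤ 0ℤ) - (s - r))) +ℤ ((s′ - r′) - n)) +ℤ (r′ - r) ≡ -[1+ 0 ]
exit-eqV = solve-∀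

exit-eqH : ∀ r r′ s s′ n →
  ((((s - (1ℤ +ℤ s′)) +ℤ (s - (1ℤ +ℤ s′))) +ℤ ((n +ℤ 1ℤ) - (s +ℤ r))) +ℤ ((s′ +ℤ r′) - n)) +ℤ ((r - s) - (r′ - s′)) ≡ -[1+ 0 ]
exit-eqH = solve-∀

exit-arithV : ∀ n r s r′ s′ → s - r ≤ℤ n +ℤ 0ℤ → n ≤ℤ s′ - r′ → r ≤ℤ r′ → 1ℤ +ℤ s′ ≤ℤ s → ⊥
exit-arithV n r s r′ s′ ep et e h = absurd-gap (exit-eqV r r′ s s′ n) (gap h ⊕ gap ep ⊕ gap et ⊕ gap e)

exit-arithH : ∀ n r s r′ s′ → s +ℤ r ≤ℤ n +ℤ 1ℤ → n ≤ℤ s′ +ℤ r′ → r′ - s′ ≤ℤ r - s → 1ℤ +ℤ s′ ≤ℤ s → ⊥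
exit-arithH n r s r′ s′ ep et e h =
  absurd-gap (exit-eqH r r′ s s′ n) (gap h ⊕ gap h ⊕ gap ep ⊕ gap et ⊕ gap e)

exit-arith : ∀ i n p t → coord i p ≤ℤ n +ℤ width i → n ≤ℤ coord i t → κ i t ≡ κ i p → ¬ 1ℤ +ℤ ss t ≤ℤ ss p
exit-arith V n (r , s) (r′ , s′) ep et e h = exit-arithV n r s r′ s′ ep et (ℤₚ.≤-reflexive (sym e)) h
exit-arith H n (r , s) (r′ , s′) ep et e h = exit-arithH n r s r′ s′ ep et (ℤₚ.≤-reflexive e) h

-- The next point of the curve is already outside `Q n`, and `coord i` keeps falling along it.
exit-off : ∀ i n p t → Exit i n p → Q n t → t ≢ p → OffCurve i p t
exit-off i n p t (qp , ep) qt t≢p eqκ st≤sp with ss p ℤₚ.≤? ss t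
... | yes sp≤st = t≢p (κ-injective i p t eqκ (ℤₚ.≤-antisym st≤sp sp≤st))
... | no sp≰st = exit-arith i (+ n) p t ep (qt i) eqκ (≰⇒1+≤ sp≰st)

rightOf-row : ∀ l t → ss l ≢ ss t → rightOf l t ≡ false
rightOf-row (a , b) (c , d) h with b - d in e
... | + zero = ⊥-elim (h (ℤₚ.i-j≡0⇒i≡j b d e))
... | + suc _ = refl
... | -[1+ _ ] = refl

rightOf-≥ : ∀ l t → rr t ≤ℤ rr l → rightOf l t ≡ false
rightOf-≥ (a , b) (c , d) h with b - d | a - c | gap h
... | + zero | + _ | _ = refl
... | + suc _ | _ | _ = refl
... | -[1+ _ ] | _ | _ = refl

≤⇒le0 : ∀ x y → x ≤ℤ y → le0 (x - y) ≡ true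
≤⇒le0 x y h with x - y | ℤₚ.i≤j⇒i-j≤0 h
... | + zero | _ = refl
... | -[1+ _ ] | _ = refl
... | + suc _ | +≤+ ()

<⇒pos : ∀ x y → 1ℤ +ℤ y ≤ℤ x → pos (x - y) ≡ true
<⇒pos x y h with pos (x - y) in e
... | true = refl
... | false = ⊥-elim (ℤₚ.<⇒≱ (ℤₚ.suc[i]≤j⇒i<j h) (ℤₚ.i-j≤0⇒i≤j (nonpos (x - y) e)))
  where nonpos : ∀ z → pos z ≡ false → z ≤ℤ 0ℤ
        nonpos (+ zero) _ = ℤₚ.≤-refl
        nonpos -[1+ _ ] _ = -≤+

<⇒neg : ∀ x y → 1ℤ +ℤ x ≤ℤ y → neg (x - y) ≡ true
<⇒neg x y h with neg (x - y) in e
... | true = refl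
... | false = ⊥-elim (ℤₚ.<⇒≱ (ℤₚ.suc[i]≤j⇒i<j h) (nonneg⇒≤ x y e))

-- The order of the boundary of Q n, oriented so that the points far out along side i come first.
Precedes : Side → Side → Pt → Side → Pt → Set
Precedes V j q k p = leftOf j q k p ≡ true
Precedes H j q k p = leftOf k p j q ≡ true

far-eq₁ : ∀ s t n a b → (((s - (1ℤ +ℤ (n +ℤ (a +ℤ b)))) +ℤ (a - t)) +ℤ n) +ℤ b ≡ s - (1ℤ +ℤ t)
far-eq₁ = solve-∀

far-eq₂ : ∀ r s t n a b → (((s - (1ℤ +ℤ (n +ℤ (a +ℤ b)))) +ℤ (b - t)) +ℤ ((n +ℤ 0ℤ) - (s - r))) +ℤ a ≡ r - (1ℤ +ℤ t)
far-eq₂ = solve-∀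

far-eq₃ : ∀ r s r′ s′ n a b →
  (((((((s - (1ℤ +ℤ (n +ℤ (a +ℤ b)))) +ℤ (s - (1ℤ +ℤ (n +ℤ (a +ℤ b))))) +ℤ (a - s′)) +ℤ (b - (- r′))) +ℤ
    ((n +ℤ 1ℤ) - (s +ℤ r))) +ℤ n) +ℤ a) +ℤ b ≡ (r′ - s′) - (1ℤ +ℤ (r - s))
far-eq₃ = solve-∀

far-arith₁ : ∀ {n a b} s t → 0ℤ ≤ℤ n → 0ℤ ≤ℤ b → t ≤ℤ a → 1ℤ +ℤ (n +ℤ (a +ℤ b)) ≤ℤ s → 1ℤ +ℤ t ≤ℤ s
far-arith₁ {n} {a} {b} s t hn hb ta h = by-gap (far-eq₁ s t n a b) (gap h ⊕ gap ta ⊕ hn ⊕ hb)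

far-arith₂ : ∀ {n a b} r s t → 0ℤ ≤ℤ a → t ≤ℤ b → s - r ≤ℤ n +ℤ 0ℤ → 1ℤ +ℤ (n +ℤ (a +ℤ b)) ≤ℤ s → 1ℤ +ℤ t ≤ℤ r
far-arith₂ {n} {a} {b} r s t ha tb ex h = by-gap (far-eq₂ r s t n a b) (gap h ⊕ gap tb ⊕ gap ex ⊕ ha)

far-arith₃ : ∀ {n a b} r s r′ s′ → 0ℤ ≤ℤ n → 0ℤ ≤ℤ a → 0ℤ ≤ℤ b → s′ ≤ℤ a → - r′ ≤ℤ b → s +ℤ r ≤ℤ n +ℤ 1ℤ →
  1ℤ +ℤ (n +ℤ (a +ℤ b)) ≤ℤ s → 1ℤ +ℤ (r - s) ≤ℤ r′ - s′
far-arith₃ {n} {a} {b} r s r′ s′ hn ha hb sa rb ex h =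
  by-gap (far-eq₃ r s r′ s′ n a b) (gap h ⊕ gap h ⊕ gap sa ⊕ gap rb ⊕ gap ex ⊕ hn ⊕ ha ⊕ hb)

-- At an exit of side `i` the coordinate `coord i` is pinned near `n`, so a large `s` forces a large
-- positive `r` for `V` and a large negative one for `H`. The constant `K` makes this exceed the
-- coordinates of `p`.
far : ∀ i n k p → ∃[ K ] (∀ q → Exit i n q → 1ℤ +ℤ + K ≤ℤ ss q → Precedes i i q k p)
far i n k p@(rp , sp) = K , precedes i
  where
  K = n +ℕ (∣ sp ∣ +ℕ ∣ rp ∣)
  below : ∀ q → 1ℤ +ℤ + K ≤ℤ ss q → 1ℤ +ℤ sp ≤ℤ ss q
  below q h = far-arith₁ (ss q) sp (0≤ n) (0≤ ∣ rp ∣) (i≤+∣i∣ sp) h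
  precedes : ∀ i q → Exit i n q → 1ℤ +ℤ + K ≤ℤ ss q → Precedes i i q k p
  precedes V q@(rq , sq) (_ , ex) h = cong₂ _xor_
    (cong₂ _∧_ (≤⇒le0 sp sq sp≤sq) (<⇒neg rp rq (far-arith₂ {+ n} rq sq rp (0≤ ∣ sp ∣) (i≤+∣i∣ rp) ex h)))
    (cong (_∧ neg (κ k p - κ k q)) (pos-≤ sp sq sp≤sq))
    where sp≤sq = ℤₚ.<⇒≤ (ℤₚ.suc[i]≤j⇒i<j (below q h))
  precedes H q@(rq , sq) (_ , ex) h = cong₂ _xor_
    (cong (_∧ neg (κ k q - κ k p)) (le0-< sq sp (ℤₚ.suc[i]≤j⇒i<j (below q h))))
    (cong₂ _∧_ (<⇒pos sq sp (below q h)) (<⇒neg (κ H q) (κ H p)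
      (far-arith₃ rq sq rp sp (0≤ n) (0≤ ∣ sp ∣) (0≤ ∣ rp ∣) (i≤+∣i∣ sp)
        (subst (- rp ≤ℤ_) (cong +_ (ℤₚ.∣-i∣≡∣i∣ rp)) (i≤+∣i∣ (- rp))) ex h)))

precedes-total : ∀ i n j q k p → Exit j n q → Exit k n p → q ≢ p → Precedes i j q k p ⊎ Precedes i k p j q
precedes-total i n j q k p eq ep q≢p = choose i (leftOf-total j q k p
    (exit-off j n q p eq (proj₁ ep) (q≢p ∘ sym)) (exit-off k n p q ep (proj₁ eq) q≢p))
  where
  choose : ∀ i → leftOf j q k p xor leftOf k p j q ≡ true → Precedes i j q k p ⊎ Precedes i k p j q
  choose i h with leftOf j q k p in e | leftOf k p j q in e′
  choose V h | true | _ = inj₁ e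
  choose V h | false | true = inj₂ e′
  choose H h | true | _ = inj₂ e
  choose H h | false | true = inj₁ e′

-- In a row, moving to the right increases X = s - r and decreases Y = s + r.
rightOf-coordV : ∀ l t → coord V l ≤ℤ coord V t → rightOf l t ≡ false
rightOf-coordV l@(a , b) t@(c , d) h with b ℤₚ.≟ d
... | no b≢d = rightOf-row l t b≢d
... | yes refl = rightOf-≥ l t (by-gap (eq a b c) (gap h))
  where eq : ∀ a b c → (b - c) - (b - a) ≡ a - c
        eq = solve-∀

rightOf-coordH : ∀ l t → coord H t ≤ℤ coord H l → rightOf l t ≡ false
rightOf-coordH l@(a , b) t@(c , d) h with b ℤₚ.≟ d
... | no b≢d = rightOf-row l t b≢d
... | yes refl = rightOf-≥ l t (by-gap (eq a b c) (gap h))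
  where eq : ∀ a b c → (b +ℤ a) - (b +ℤ c) ≡ a - c
        eq = solve-∀

≤<⇒≢ : ∀ {a b k} → a ≤ℤ + k → + suc k ≤ℤ b → a ≢ b
≤<⇒≢ h h′ refl with ℤₚ.≤-trans h′ h
... | +≤+ 1+k≤k = ℕₚ.<-irrefl refl 1+k≤k

-- Components of quarter-planes, hugging and blocking

module Planar (B : Pt → Set) where

  Black : ℕ → Pt → Set
  Black n t = Q n t × B t

  Conn : ℕ → Pt → Pt → Set
  Conn n = Walk (Black n)

  Conn-mono : ∀ {m n t u} → m ≤ n → Conn n t u → Conn m t u
  Conn-mono m≤n = walk-map λ {t} (q , b) → Q-mono t m≤n q , b

  HugsWithin : Side → ℕ → Pt → ℕ → Set
  HugsWithin i n t b = ∀ y → ∃[ f ] (Conn n t f × coord i f ≤ℤ + b × + y ≤ℤ ss f)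

  -- The component of t in Q n is unbounded in a strip along side i.
  Hugs : Side → ℕ → Pt → Set
  Hugs i n t = ∃[ b ] HugsWithin i n t b

  Unbounded : ℕ → Pt → Set
  Unbounded n t = ∀ y → ∃[ f ] (Conn n t f × + y ≤ℤ ss f)

  -- If the component of p hugs side i up to distance b, then a component leaving the boundary of Q n
  -- before p and continuing to infinity at distance at least b would have to cross it.
  blocks : EM → ∀ i n j q k p b {M e} → Exit j n q → Exit k n p → Precedes i j q k p →
    HugsWithin i n p b → Conn n q e → n ≤ M → b ≤ M → Unbounded M e → Conn n p q
  blocks em i n j q k p b {M} {e} exq exp q≺p hug P n≤M b≤M unb = stable em λ ¬c →
    -- The choices alternate: `f` above all of `P`, then `e′` above all of the walk from `p` to `f`.
    let (KP , P′) = walk-bound P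
        (f , Z , cf , yf) = hug (suc KP)
        (KZ , Z′) = walk-bound Z
        (e′ , E , ye) = unb (suc KZ)
        -- Points above height `KP` come from `E`, which stays in `Q M`. They are at least as far
        -- from side `i` as `f` is, so the half-row from `f` towards that side is free of them.
        Γ : Walk (λ t → Conn n q t × (ss t ≤ℤ + KP ⊎ + b ≤ℤ coord i t)) q e′
        Γ = walk-reach (stop (walk-head P))
          (walk-map (λ (a , h) → a , inj₁ h) P′ ++
           walk-map (λ {t} (qt , bt) → (Q-mono t n≤M qt , bt) , inj₂ (ℤₚ.≤-trans (+≤+ b≤M) (qt i))) E)
        Z″ : Walk (λ t → Conn n p t × ss t ≤ℤ + KZ) p f
        Z″ = walk-reach (stop (walk-head Z)) Z′
        disjoint : ∀ {t} → Conn n q t → Conn n p t → ⊥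
        disjoint γ ζ = ¬c (ζ ++ reverse γ)
        offq : ∀ {t} → Conn n p t → OffCurve j q t
        offq {t} ζ = exit-off j n q t exq (proj₁ (walk-last ζ)) (λ { refl → ¬c ζ })
        offp : ∀ {t} → Conn n q t → OffCurve k p t
        offp {t} γ = exit-off k n p t exp (proj₁ (walk-last γ)) (λ { refl → ¬c (reverse γ) })
        p<f : ss q <ℤ ss f
        p<f = ℤₚ.≤-<-trans (proj₂ (walk-head P′)) (ℤₚ.suc[i]≤j⇒i<j yf)
        p<e : ss p <ℤ ss e′
        p<e = ℤₚ.≤-<-trans (proj₂ (walk-head Z′)) (ℤₚ.suc[i]≤j⇒i<j ye)
    in conclude i q≺p f e′ KP KZ cf yf ye Γ Z″ disjoint offq offp p<f p<e
    where
    conclude : ∀ i → Precedes i j q k p → ∀ f e′ KP KZ → coord i f ≤ℤ + b → + suc KP ≤ℤ ss f → + suc KZ ≤ℤ ss e′ →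
      Walk (λ t → Conn n q t × (ss t ≤ℤ + KP ⊎ + b ≤ℤ coord i t)) q e′ →
      Walk (λ t → Conn n p t × ss t ≤ℤ + KZ) p f →
      (∀ {t} → Conn n q t → Conn n p t → ⊥) →
      (∀ {t} → Conn n p t → OffCurve j q t) → (∀ {t} → Conn n q t → OffCurve k p t) →
      ss q <ℤ ss f → ss p <ℤ ss e′ → ⊥
    conclude V q≺p f e′ KP KZ cf yf ye Γ Z dis offq offp q<f p<e
      with trans (sym q≺p) (crossing j k (λ (γ , _) (ζ , _) → dis γ ζ) Γ Z (λ (ζ , _) → offq ζ) (λ (γ , _) → offp γ)
        (λ {t} (_ , h) → rightOf-row t e′ (≤<⇒≢ h ye))
        (λ { {t} (_ , inj₁ h) → rightOf-row f t (λ e → ≤<⇒≢ h yf (sym e))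
           ; {t} (_ , inj₂ h) → rightOf-coordV f t (ℤₚ.≤-trans cf h) })
        q<f (ℤₚ.<⇒≤ p<e))
    ... | ()
    -- For `H` the boundary order runs the other way, so the two walks exchange roles.
    conclude H q≺p f e′ KP KZ cf yf ye Γ Z dis offq offp q<f p<e
      with trans (sym q≺p) (crossing k j (λ (ζ , _) (γ , _) → dis γ ζ) Z Γ (λ (γ , _) → offp γ) (λ (ζ , _) → offq ζ)
        (λ { {t} (_ , inj₁ h) → rightOf-row t f (≤<⇒≢ h yf) ; {t} (_ , inj₂ h) → rightOf-coordH t f (ℤₚ.≤-trans cf h) })
        (λ {t} (_ , h) → rightOf-row e′ t (λ e → ≤<⇒≢ h ye (sym e)))
        p<e (ℤₚ.<⇒≤ q<f))
    ... | ()

  Attached : Pt → Set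
  Attached w = ∃[ z ] (¬ Q 0 z × Walk B w z)

  -- A walk ending outside `Q 0` leaves `Q n` at some step. Its last point before doing so is an
  -- exit, since one step lowers `coord i` by at most `width i +ℤ 1ℤ`.
  exit : ∀ n {w z} → Q n w → Walk B w z → ¬ Q 0 z → ∃[ i ] ∃[ p ] (Exit i n p × Conn n w p)
  exit n {w} qw (stop b) ¬qz = ⊥-elim (¬qz (Q-mono w z≤n qw))
  exit n {w} qw (go b d W) ¬qz with Q? n (move d w)
  ... | yes q′ with exit n q′ W ¬qz
  ...   | i , p , ex , c = i , p , ex , go (qw , b) d c
  exit n {w} qw (go b d W) ¬qz | no ¬q′ with ¬Q⇒coord n (move d w) ¬q′
  ... | i , h = i , w ,
    (qw , by-gap (eq (+ n) (coord i w) (coord i (move d w)) (width i)) (gap h ⊕ gap (coord-move i d w))) , stop (qw , b)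
    where eq : ∀ n c c′ w → (n - (1ℤ +ℤ c′)) +ℤ (((c′ +ℤ w) +ℤ 1ℤ) - c) ≡ (n +ℤ w) - c
          eq = solve-∀

-- Compactness

-- An index failing at level `k` fails at all later levels, so it can be struck from the list once
-- only levels above `k` are consulted.
pigeonhole : EM → {I : Set} {A : I → ℕ → Set} → (∀ {i m k} → m ≤ k → A i k → A i m) → (l : List I) →
  (∀ m → ∃[ i ] (i ∈ l × A i m)) → ∃[ i ] (∀ m → A i m)
pigeonhole em anti [] h with h 0
... | _ , () , _
pigeonhole em {A = A} anti (i ∷ l) h with em {∀ m → A i m}
... | yes a = i , a
... | no ¬a with ¬∀⇒∃¬ em ¬a
...   | k , ¬ak = pigeonhole em anti l rest
  where
  rest : ∀ m → ∃[ j ] (j ∈ l × A j m)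
  rest m with h (m ⊔ k)
  ... | _ , here refl , a = ⊥-elim (¬ak (anti (ℕₚ.m≤n⊔m m k) a))
  ... | j , there j∈l , a = j , j∈l , anti (ℕₚ.m≤m⊔n m k) a

interval : ℕ → List ℤ
interval K = mapₗ +_ (upTo (suc K)) ++ₗ mapₗ -[1+_] (upTo K)

∈-interval : ∀ K r → r ≤ℤ + K → - r ≤ℤ + K → r ∈ interval K
∈-interval K (+ a) (+≤+ a≤K) _ = ∈-++⁺ˡ (∈-map⁺ +_ (∈-upTo⁺ (s≤s a≤K)))
∈-interval K -[1+ a ] _ (+≤+ a<K) = ∈-++⁺ʳ (mapₗ +_ (upTo (suc K))) (∈-map⁺ -[1+_] (∈-upTo⁺ a<K))

box : ℕ → List Pt
box K = cartesianProduct (interval K) (interval K)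

Q⇒ss-eq : ∀ n r s → ((((s - r) - n) +ℤ ((s +ℤ r) - n)) +ℤ (n - (1ℤ +ℤ s))) +ℤ (n - (1ℤ +ℤ s)) ≡ -[1+ 1 ]
Q⇒ss-eq = solve-∀

Q⇒ss : ∀ n t → Q n t → + n ≤ℤ ss t
Q⇒ss n (r , s) q with + n ℤₚ.≤? s
... | yes h = h
... | no ¬h = ⊥-elim (absurd-gap (Q⇒ss-eq (+ n) r s) (gap (q V) ⊕ gap (q H) ⊕ gap (≰⇒1+≤ ¬h) ⊕ gap (≰⇒1+≤ ¬h)))

-- In `Q 0` the absolute value of `r` is at most `s`, so bounded height leaves finitely many points.
∈-box : ∀ K t → Q 0 t → ss t ≤ℤ + K → t ∈ box K
∈-box K t@(r , s) q s≤K = ∈-cartesianProduct⁺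
  (∈-interval K r (by-gap (eq₁ (+ K) r s) (gap s≤K ⊕ gap (q V))) (by-gap (eq₂ (+ K) r s) (gap s≤K ⊕ gap (q H))))
  (∈-interval K s s≤K (ℤₚ.≤-trans (ℤₚ.neg-mono-≤ (Q⇒ss 0 t q)) (0≤ K)))
  where
  eq₁ : ∀ k r s → (k - s) +ℤ ((s - r) - 0ℤ) ≡ k - r
  eq₁ = solve-∀
  eq₂ : ∀ k r s → (k - s) +ℤ ((s +ℤ r) - 0ℤ) ≡ k - (- r)
  eq₂ = solve-∀

-- Descent through nested components

-- The sides that all components along a path to infinity hug.
data Case : Set where
  none both : Case
  only : Side → Case

required : Case → Side → Bool
required none _ = false
required both _ = true
required (only V) V = true
required (only V) H = false
required (only H) V = false
required (only H) H = true

module Components (B : Pt → Set) where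

  open Planar B public

  Hugs-mono : ∀ i {m n t} → m ≤ n → Hugs i n t → Hugs i m t
  Hugs-mono i m≤n (b , h) = b , λ y → let (f , c , rest) = h y in f , Conn-mono m≤n c , rest

  Hugs-conn : ∀ i {n t u} → Conn n u t → Hugs i n t → Hugs i n u
  Hugs-conn i w (b , h) = b , λ y → let (f , c , rest) = h y in f , w ++ c , rest

  Hugs⇒Unbounded : ∀ i {n t} → Hugs i n t → Unbounded n t
  Hugs⇒Unbounded i (b , h) y = let (f , c , _ , yf) = h y in f , c , yf

  Attached-conn : ∀ {n t u} → Conn n u t → Attached t → Attached u
  Attached-conn w (z , ¬q , w′) = z , ¬q , walk-map proj₂ w ++ w′

  Hugging : Case → ℕ → Pt → Set
  Hugging c m w = Q m w × (∀ i → required c i ≡ true → Hugs i m w)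

  -- In case `none` height alone is asked for: by `target-level`, high points of a component hugging
  -- neither side lie in the next quarter-plane.
  Target : Case → ℕ → Pt → Set
  Target none m w = + m ≤ℤ ss w
  Target both m w = Hugging both m w
  Target (only i) m w = Hugging (only i) m w

  Avoids : Case → ℕ → Pt → Set
  Avoids c n u = ∀ i → required c i ≡ false → ¬ Hugs i n u

  Hugging-anti : ∀ c {m k w} → m ≤ k → Hugging c k w → Hugging c m w
  Hugging-anti c {w = w} m≤k (q , h) = Q-mono w m≤k q , λ i r → Hugs-mono i m≤k (h i r)

  Target-anti : ∀ c {m k w} → m ≤ k → Target c k w → Target c m w
  Target-anti none m≤k h = ℤₚ.≤-trans (+≤+ m≤k) h
  Target-anti both m≤k h = Hugging-anti both m≤k h
  Target-anti (only i) m≤k h = Hugging-anti (only i) m≤k h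

  target⇒hugging : ∀ c {i m w} → required c i ≡ true → Target c m w → Hugging c m w
  target⇒hugging both _ h = h
  target⇒hugging (only _) _ h = h

  -- The invariant of the descent; its last clause is the one that compactness has to preserve.
  Alive : Case → ℕ → Pt → Set
  Alive c n u = Attached u × Avoids c n u × (∀ m → ∃[ w ] (Conn n u w × Target c m w))

  module _ (em : EM) where

    hug-bound : ∀ i {n u} → ¬ Hugs i n u → ∀ b → ∃[ K ] (∀ {z} → Conn n u z → coord i z ≤ℤ + b → ss z ≤ℤ + K)
    hug-bound i ¬h b with ¬∀⇒∃¬ em (λ h → ¬h (b , h))
    ... | K , ¬f = K , λ {z} c cz → [ id , (λ K≤s → ⊥-elim (¬f (z , c , cz , K≤s))) ]′ (ℤₚ.≤-total (ss z) (+ K))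

    -- If side i is hugged, a target exiting far out along side i is, by blocks, connected to the exit of a fixed target.
    exit-bound : ∀ c n u i → Alive c n u → ∃[ K ] ∃[ M ] (∀ {m w q} → M ≤ m → Conn n u w → Target c m w →
      Exit i (suc n) q → Conn (suc n) w q → ∃[ p ] (ss p ≤ℤ + K × Conn (suc n) p w))
    exit-bound c n u i (att , avoids , good) with required c i in req
    -- Exits of side `i` lie in the strip up to distance `suc n +ℕ 1`, where a component not hugging
    -- `i` has bounded height; the exit `q` itself serves.
    ... | false = let (K , bound) = hug-bound i (avoids i req) (suc n +ℕ 1) in K , 0 ,
      λ {m} {w} {q} _ uw _ ex wq →
        q , bound (uw ++ Conn-mono (ℕₚ.n≤1+n n) wq) (ℤₚ.≤-trans (proj₂ ex) (ℤₚ.+-monoʳ-≤ (+ suc n) (width≤1 i))) , reverse wq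
      where
      width≤1 : ∀ i → width i ≤ℤ 1ℤ
      width≤1 V = +≤+ z≤n
      width≤1 H = ℤₚ.≤-refl
    -- One target `w₁` and its exit `p₁` are fixed. The component of `p₁` hugs side `i` and so
    -- blocks all exits further out.
    ... | true with good (suc n)
    ...   | w₁ , uw₁ , tar₁ with target⇒hugging c req tar₁ | Attached-conn (reverse uw₁) att
    ...     | q₁ , hugs₁ | z , ¬qz , w₁z with hugs₁ i req | exit (suc n) q₁ w₁z ¬qz
    ...       | b , hug | k , p₁ , ex₁ , w₁p₁ with far i (suc n) k p₁
    -- Level `suc n ⊔ b` keeps the target at distance at least `b` from the side, as `blocks` needs.
    ...         | K , far-precedes = K ⊔ ∣ ss p₁ ∣ , suc n ⊔ b , bound
      where
      hug′ : HugsWithin i (suc n) p₁ b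
      hug′ y = let (f , cn , rest) = hug y in f , reverse w₁p₁ ++ cn , rest
      bound : ∀ {m w q} → suc n ⊔ b ≤ m → Conn n u w → Target c m w →
        Exit i (suc n) q → Conn (suc n) w q → ∃[ p ] (ss p ≤ℤ + (K ⊔ ∣ ss p₁ ∣) × Conn (suc n) p w)
      bound {m} {w} {q} M≤m uw tar ex wq with ss q ℤₚ.≤? + K
      ... | yes sq≤K = q , ℤₚ.≤-trans sq≤K (+≤+ (ℕₚ.m≤m⊔n K ∣ ss p₁ ∣)) , reverse wq
      ... | no sq≰K = p₁ , ℤₚ.≤-trans (i≤+∣i∣ (ss p₁)) (+≤+ (ℕₚ.m≤n⊔m K ∣ ss p₁ ∣)) ,
        (blocks em i (suc n) i q k p₁ b ex ex₁ (far-precedes q ex (≰⇒1+≤ sq≰K)) hug′ (reverse wq)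
          (ℕₚ.≤-trans (ℕₚ.m≤m⊔n (suc n) b) M≤m) (ℕₚ.≤-trans (ℕₚ.m≤n⊔m (suc n) b) M≤m)
          (Hugs⇒Unbounded i (proj₂ (target⇒hugging c req tar) i req))) ++ reverse wq

    -- In case `none` a point outside `Q (suc n)` lies in one of two strips, where heights in the
    -- component are bounded. In the other cases a target of level `m` lies in `Q m` by definition.
    target-level : ∀ c n u → Alive c n u → ∃[ M ] (∀ {m w} → M ≤ m → Conn n u w → Target c m w → Q (suc n) w)
    target-level none n u (_ , avoids , _) =
      let (KV , boundV) = hug-bound V (avoids V refl) n
          (KH , boundH) = hug-bound H (avoids H refl) n
          K : Side → ℕ
          K = λ { V → KV ; H → KH }
          bound : ∀ i {z} → Conn n u z → coord i z ≤ℤ + n → ss z ≤ℤ + K i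
          bound = λ { V → boundV ; H → boundH }
          K≤ : ∀ i → K i ≤ KV ⊔ KH
          K≤ = λ { V → ℕₚ.m≤m⊔n KV KH ; H → ℕₚ.m≤n⊔m KV KH }
      in suc (KV ⊔ KH) , λ {m} {w} M≤m uw tar → inside K bound K≤ M≤m uw tar (Q? (suc n) w)
      where
      inside : (K : Side → ℕ) → (∀ i {z} → Conn n u z → coord i z ≤ℤ + n → ss z ≤ℤ + K i) →
        ∀ {L} → (∀ i → K i ≤ L) → ∀ {m w} → suc L ≤ m → Conn n u w → + m ≤ℤ ss w → Dec (Q (suc n) w) → Q (suc n) w
      inside K bound K≤ M≤m uw tar (yes q) = q
      inside K bound K≤ {m} {w} M≤m uw tar (no ¬q) with ¬Q⇒coord (suc n) w ¬q
      ... | i , h with ℤₚ.≤-trans tar (bound i uw (by-gap (eq (+ n) (coord i w)) (gap h)))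
        where eq : ∀ n c → (1ℤ +ℤ n) - (1ℤ +ℤ c) ≡ n - c
              eq = solve-∀
      ...   | +≤+ m≤K = ⊥-elim (ℕₚ.<-irrefl refl (ℕₚ.≤-trans M≤m (ℕₚ.≤-trans m≤K (K≤ i))))
    target-level both n u _ = suc n , λ {m} {w} n<m _ (q , _) → Q-mono w n<m q
    target-level (only i) n u _ = suc n , λ {m} {w} n<m _ (q , _) → Q-mono w n<m q

    -- The step of König's lemma: `exit-bound` joins targets of all high levels, inside `Q (suc n)`,
    -- to points of one finite box, so a single point of the box serves every level.
    descend : ∀ c n u → Alive c n u → ∃[ p ] (Conn n u p × Alive c (suc n) p)
    descend c n u alive@(att , avoids , good)
      with exit-bound c n u V alive | exit-bound c n u H alive | target-level c n u alive
    ... | KV , MV , boundV | KH , MH , boundH | M , level = conclude (pigeonhole em anti (box (KV ⊔ KH)) candidate)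
      where
      A : Pt → ℕ → Set
      A p m = ∃[ w ] (Conn n u w × Target c m w × Conn (suc n) p w)
      anti : ∀ {p m k} → m ≤ k → A p k → A p m
      anti m≤k (w , uw , tar , pw) = w , uw , Target-anti c m≤k tar , pw
      L : ℕ
      L = MV ⊔ (MH ⊔ M)
      inBox : ∀ {w} p → Conn (suc n) p w → ss p ≤ℤ + (KV ⊔ KH) → p ∈ box (KV ⊔ KH)
      inBox p pw sp = ∈-box (KV ⊔ KH) p (Q-mono p z≤n (proj₁ (walk-head pw))) sp
      candidate : ∀ m → ∃[ p ] (p ∈ box (KV ⊔ KH) × A p m)
      candidate m with good (m ⊔ L)
      ... | w , uw , tar with level M≤ uw tar | Attached-conn (reverse uw) att
        where M≤ = ℕₚ.≤-trans (ℕₚ.≤-trans (ℕₚ.m≤n⊔m MH M) (ℕₚ.m≤n⊔m MV (MH ⊔ M))) (ℕₚ.m≤n⊔m m L)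
      ...   | q′ | z , ¬qz , wz with exit (suc n) q′ wz ¬qz
      ...     | V , q , ex , wq = let (p , sp , pw) = boundV MV≤ uw tar ex wq in
        p , inBox p pw (ℤₚ.≤-trans sp (+≤+ (ℕₚ.m≤m⊔n KV KH))) , w , uw , Target-anti c (ℕₚ.m≤m⊔n m L) tar , pw
        where MV≤ = ℕₚ.≤-trans (ℕₚ.m≤m⊔n MV (MH ⊔ M)) (ℕₚ.m≤n⊔m m L)
      ...     | H , q , ex , wq = let (p , sp , pw) = boundH MH≤ uw tar ex wq in
        p , inBox p pw (ℤₚ.≤-trans sp (+≤+ (ℕₚ.m≤n⊔m KV KH))) , w , uw , Target-anti c (ℕₚ.m≤m⊔n m L) tar , pw
        where MH≤ = ℕₚ.≤-trans (ℕₚ.≤-trans (ℕₚ.m≤m⊔n MH M) (ℕₚ.m≤n⊔m MV (MH ⊔ M))) (ℕₚ.m≤n⊔m m L)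
      conclude : ∃[ p ] (∀ m → A p m) → ∃[ p ] (Conn n u p × Alive c (suc n) p)
      -- Any target joined to `p` also joins `p` to `u` inside `Q n`; the one of level 0 is used.
      conclude (p , h) = let (w , uw , _ , pw) = h 0
                             to-p : Conn n u p
                             to-p = uw ++ reverse (Conn-mono (ℕₚ.n≤1+n n) pw)
        in p , to-p , Attached-conn (reverse to-p) att ,
          (λ i req hugs → avoids i req (Hugs-conn i to-p (Hugs-mono i (ℕₚ.n≤1+n n) hugs))) ,
          λ m → let (w , _ , tar , pw) = h m in w , pw , tar

-- Infinite paths

record Reaches (B : Pt → Set) (v : Pt) : Set where
  field
    path : ℕ → Pt
    path-start : path 0 ≡ v
    path-step : ∀ k → ∃[ d ] (path (suc k) ≡ move d (path k))
    path-black : ∀ k → B (path k)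
    path-reach : ∀ n → ∃[ k ] (∀ l → k ≤ l → Q n (path l))

open Reaches public

prepend : ∀ {B u v} → Walk B v u → Reaches B u → Reaches B v
prepend (stop _) ρ = ρ
prepend {B} {v = v} (go b d w) ρ′ = record
  { path = λ { zero → v ; (suc k) → path ρ k }
  ; path-start = refl
  ; path-step = λ { zero → d , path-start ρ ; (suc k) → path-step ρ k }
  ; path-black = λ { zero → b ; (suc k) → path-black ρ k }
  ; path-reach = λ n → let (k , h) = path-reach ρ n in suc k , λ { (suc l) (s≤s k≤l) → h l k≤l } }
  where ρ = prepend w ρ′

module Chain (B : Pt → Set) (I : ℕ → Pt → Set)
  (inside : ∀ {n u} → I n u → Q n u) (descend : ∀ {n u} → I n u → ∃[ p ] (Planar.Conn B n u p × I (suc n) p)) where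

  open Planar B

  descend-by : ∀ k {n u} → I n u → ∃[ p ] (Conn n u p × I (k +ℕ n) p)
  descend-by zero {n} {u} a = let (_ , w , _) = descend a in u , stop (walk-head w) , a
  descend-by (suc k) a with descend-by k a
  ... | p , w , a′ with descend a′
  ...   | p′ , w′ , a″ = p′ , w ++ Conn-mono (ℕₚ.m≤n+m _ k) w′ , a″

  -- A partially traversed walk in Q n from u to a point p at a higher level.
  record State (n : ℕ) (u : Pt) : Set where
    constructor state
    field
      {p} : Pt
      {m} : ℕ
      dir : Dir
      black : Black n u
      walk : Conn n (move dir u) p
      n<m : n < m
      inv : I m p

  start : ∀ {n u} → I n u → State n u
  -- Climbing past the coordinate of `u` excludes the trivial walk, so there is a first step to
  -- take.
  start {n} {u} a with descend-by (suc ∣ coord V u ∣) a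
  ... | p , go b d w , a′ = state d b w (s≤s (ℕₚ.m≤n+m n ∣ coord V u ∣)) a′
  ... | _ , stop _ , a′ = ⊥-elim (ℤₚ.<⇒≱ (ℤₚ.suc[i]≤j⇒i<j u<) (inside a′ V))
    where
    u< : 1ℤ +ℤ coord V u ≤ℤ + (suc ∣ coord V u ∣ +ℕ n)
    u< = ℤₚ.≤-trans (ℤₚ.+-monoʳ-≤ 1ℤ (i≤+∣i∣ (coord V u))) (+≤+ (s≤s (ℕₚ.m≤m+n ∣ coord V u ∣ n)))

  Position : Set
  Position = ∃[ n ] ∃[ u ] State n u

  -- Each call takes one step. When the current walk is used up, its end point begins the next
  -- climb, at level `m`.
  advance : Position → Position
  advance (n , u , state {m = m} d b (stop _) n<m a) = m , move d u , start a
  advance (n , u , state d b (go b′ d′ w) n<m a) = n , move d u , state d′ b′ w n<m a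

  run : ℕ → Position → Position
  run zero x = x
  run (suc k) x = advance (run k x)

  run-advance : ∀ k x → run k (advance x) ≡ advance (run k x)
  run-advance zero x = refl
  run-advance (suc k) x = cong advance (run-advance k x)

  run-+ : ∀ k l x → run k (run l x) ≡ run (k +ℕ l) x
  run-+ zero l x = refl
  run-+ (suc k) l x = cong advance (run-+ k l x)

  advance-step : ∀ x → ∃[ d ] (proj₁ (proj₂ (advance x)) ≡ move d (proj₁ (proj₂ x)))
  advance-step (n , u , state d b (stop _) n<m a) = d , refl
  advance-step (n , u , state d b (go b′ d′ w) n<m a) = d , refl

  advance-level : ∀ x → proj₁ x ≤ proj₁ (advance x)
  advance-level (n , u , state d b (stop _) n<m a) = ℕₚ.<⇒≤ n<m
  advance-level (n , u , state d b (go b′ d′ w) n<m a) = ℕₚ.≤-refl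

  run-level : ∀ k x → proj₁ x ≤ proj₁ (run k x)
  run-level zero x = ℕₚ.≤-refl
  run-level (suc k) x = ℕₚ.≤-trans (run-level k x) (advance-level (run k x))

  rise : ∀ {n u p m} d b (w : Conn n (move d u) p) (n<m : n < m) (a : I m p) →
    ∃[ k ] (n < proj₁ (run k (n , u , state d b w n<m a)))
  rise d b (stop _) n<m a = 1 , n<m
  rise {n} {u} d b (go b′ d′ w) n<m a with rise d′ b′ w n<m a
  ... | k , h = suc k , subst (λ x → n < proj₁ x) (run-advance k (n , u , state d b (go b′ d′ w) n<m a)) h

  level-unbounded : ∀ n x → ∃[ k ] (n ≤ proj₁ (run k x))
  level-unbounded zero x = 0 , z≤n
  level-unbounded (suc n) x with level-unbounded n x
  ... | k , h with run k x in e
  ...   | _ , _ , state d b w n<m a with rise d b w n<m a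
  ...     | l , h′ = l +ℕ k , ℕₚ.≤-trans (s≤s h)
    (subst (λ y → _ < proj₁ y) (trans (cong (run l) (sym e)) (run-+ l k x)) h′)

  chain-reaches : ∀ {n u} → I n u → Reaches B u
  chain-reaches {n} {u} a = record
    { path = λ k → proj₁ (proj₂ (run k x))
    ; path-start = refl
    ; path-step = λ k → advance-step (run k x)
    ; path-black = λ k → proj₂ (black (proj₂ (proj₂ (run k x))))
    ; path-reach = λ n → let (k , h) = level-unbounded n x in k , λ l k≤l →
        Q-mono _ (ℕₚ.≤-trans h (later k l k≤l)) (proj₁ (black (proj₂ (proj₂ (run l x))))) }
    where
    open State
    x : Position
    x = n , u , start a
    later : ∀ k l → k ≤ l → proj₁ (run k x) ≤ proj₁ (run l x)
    later k l k≤l = subst (λ y → _ ≤ proj₁ y) (trans (run-+ (l ∸ k) k x) (cong (λ j → run j x) (ℕₚ.m∸n+n≡m k≤l)))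
      (run-level (l ∸ k) (run k x))

path-walk : ∀ {A : Pt → Set} {f : ℕ → Pt} {k l} → (∀ j → ∃[ d ] (f (suc j) ≡ move d (f j))) →
  (∀ j → k ≤ j → A (f j)) → k ≤ l → Walk A (f k) (f l)
path-walk {A} {f} {k} {l} step a k≤l = subst (λ j → Walk A (f k) (f j)) (ℕₚ.m∸n+n≡m k≤l) (along (l ∸ k))
  where
  along : ∀ j → Walk A (f k) (f (j +ℕ k))
  along zero = stop (a k ℕₚ.≤-refl)
  along (suc j) with step (j +ℕ k) | a (suc j +ℕ k) (ℕₚ.m≤n+m k (suc j))
  ... | d , eq | a′ rewrite eq = along j ++ go (a _ (ℕₚ.m≤n+m k j)) d (stop a′)

-- The criterion for reaching infinity

module Criterion (B : Pt → Set) where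

  open Components B public

  Plenty : Case → Set
  Plenty c = ∀ m → ∃[ w ] (Target c m w × Attached w)

  -- With `Plenty` this puts targets of every level into the component of `u`.
  Captures : Case → ℕ → Pt → ℕ → Set
  Captures c N u k = ∀ m → k ≤ m → ∀ w → Target c m w → Attached w → Conn N w u

  -- In case `none` targets are merely high points, so unboundedness already supplies them.
  Dominates : Case → ℕ → Pt → ℕ → Set
  Dominates none N u k = Unbounded N u
  Dominates both N u k = Captures both N u k
  Dominates (only i) N u k = Captures (only i) N u k

  Leads : Case → Pt → Set
  Leads c v = ∃[ N ] ∃[ u ] ∃[ k ] (Walk B v u × Attached u × Avoids c N u × Dominates c N u k)

  dominates-good : ∀ c N u k → Plenty c → Dominates c N u k → ∀ m → ∃[ w ] (Conn N u w × Target c m w)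
  dominates-good none N u k plenty dom m = dom m
  dominates-good both N u k plenty dom m = let (w , tar , att) = plenty (m ⊔ k) in
    w , reverse (dom (m ⊔ k) (ℕₚ.m≤n⊔m m k) w tar att) , Target-anti both (ℕₚ.m≤m⊔n m k) tar
  dominates-good (only i) N u k plenty dom m = let (w , tar , att) = plenty (m ⊔ k) in
    w , reverse (dom (m ⊔ k) (ℕₚ.m≤n⊔m m k) w tar att) , Target-anti (only i) (ℕₚ.m≤m⊔n m k) tar

  module _ (em : EM) where

    leads⇒reaches : ∀ c v → Plenty c → Leads c v → Reaches B v
    leads⇒reaches c v plenty (N , u , k , vu , att , avoids , dom) = prepend vu
      (Chain.chain-reaches B (Alive c)
        (λ (_ , _ , good) → proj₁ (walk-head (proj₁ (proj₂ (good 0)))))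
        (λ {n} {u} → descend em c n u)
        (att , avoids , dominates-good c N u k plenty dom))

    module _ {v : Pt} (att : Attached v) (ρ : Reaches B v) where

      time : ℕ → ℕ
      time m = proj₁ (path-reach ρ m)

      tail : ℕ → Pt
      tail m = path ρ (time m)

      tail-walk : ∀ m {l} → time m ≤ l → Conn m (tail m) (path ρ l)
      tail-walk m = path-walk (path-step ρ) λ l h → proj₂ (path-reach ρ m) l h , path-black ρ l

      tail-conn : ∀ {m n} → m ≤ n → Conn m (tail m) (tail n)
      tail-conn {m} {n} m≤n = tail-walk m (ℕₚ.m≤m⊔n (time m) (time n)) ++
        reverse (Conn-mono m≤n (tail-walk n (ℕₚ.m≤n⊔m (time m) (time n))))

      tail-Q : ∀ m → Q m (tail m)
      tail-Q m = proj₁ (walk-head (tail-conn (ℕₚ.≤-refl {m})))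

      tail-unbounded : ∀ m → Unbounded m (tail m)
      tail-unbounded m y = tail (m ⊔ y) , tail-conn (ℕₚ.m≤m⊔n m y) ,
        Q⇒ss y (tail (m ⊔ y)) (Q-mono (tail (m ⊔ y)) (ℕₚ.m≤n⊔m m y) (tail-Q (m ⊔ y)))

      start-tail : ∀ m → Walk B v (tail m)
      start-tail m = subst (λ t → Walk B t (tail m)) (path-start ρ) (path-walk (path-step ρ) (λ l _ → path-black ρ l) z≤n)

      tail-attached : ∀ m → Attached (tail m)
      tail-attached m = let (z , ¬q , w) = att in z , ¬q , reverse (start-tail m) ++ w

      -- Of the exits `p` of the tail and `q` of the target, the later one in the boundary order
      -- blocks the earlier. Both components hug side `i`, and both continue to infinity deeper
      -- inside.
      captures : ∀ c i N → required c i ≡ true → Hugs i N (tail N) → ∃[ k ] Captures c N (tail N) k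
      captures c i N req (b , hug) with tail-attached N
      ... | z , ¬qz , w with exit N (tail-Q N) w ¬qz
      ...   | k , p , exp , tp = N ⊔ b , captured
        where
        captured : Captures c N (tail N) (N ⊔ b)
        captured m M≤m w tar (z , ¬qz , wz) with target⇒hugging c req tar
        ... | qw , hugs with exit N (Q-mono w (ℕₚ.≤-trans (ℕₚ.m≤m⊔n N b) M≤m) qw) wz ¬qz | hugs i req
        ...   | j , q , exq , wq | b′ , hug′ = wq ++ q~p ++ reverse tp
          where
          N≤m = ℕₚ.≤-trans (ℕₚ.m≤m⊔n N b) M≤m
          p-hug : HugsWithin i N p b
          p-hug y = let (f , cn , rest) = hug y in f , reverse tp ++ cn , rest
          q-hug : HugsWithin i N q b′
          q-hug y = let (f , cn , rest) = hug′ y in f , reverse wq ++ Conn-mono N≤m cn , rest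
          q~p : Conn N q p
          q~p with ≡-dec ℤₚ._≟_ ℤₚ._≟_ q p
          ... | yes refl = stop (walk-last wq)
          ... | no q≢p with precedes-total i N j q k p exq exp q≢p
          ...   | inj₁ q≺p = reverse (blocks em i N j q k p b exq exp q≺p p-hug (reverse wq) N≤m
                    (ℕₚ.≤-trans (ℕₚ.m≤n⊔m N b) M≤m) (Hugs⇒Unbounded i (b′ , hug′)))
          -- The distance `b′` depends on the target, but the path enters every quarter-plane, so it
          -- can be followed to level `N ⊔ b′`.
          ...   | inj₂ p≺q = blocks em i N k p j q b′ exp exq p≺q q-hug
                    (reverse tp ++ tail-conn (ℕₚ.m≤m⊔n N b′)) (ℕₚ.m≤m⊔n N b′) (ℕₚ.m≤n⊔m N b′) (tail-unbounded (N ⊔ b′))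

      never : ∀ i {m n} → m ≤ n → ¬ Hugs i m (tail m) → ¬ Hugs i n (tail n)
      never i m≤n ¬h h = ¬h (Hugs-conn i (tail-conn m≤n) (Hugs-mono i m≤n h))

      Always : Side → Set
      Always i = ∀ m → Hugs i m (tail m)

      -- Failure to hug a side at one level persists at all deeper levels, so each side is hugged
      -- always or, from some level on, never.
      classify : ∃[ c ] ∃[ N ] (Avoids c N (tail N) × (∀ i → required c i ≡ true → Always i))
      classify with em {Always V} | em {Always H}
      ... | yes v | yes h = both , 0 , (λ { _ () }) , λ { V _ → v ; H _ → h }
      ... | yes v | no ¬h = let (N , ¬hN) = ¬∀⇒∃¬ em ¬h in only V , N , (λ { H _ → ¬hN }) , λ { V _ → v }
      ... | no ¬v | yes h = let (N , ¬vN) = ¬∀⇒∃¬ em ¬v in only H , N , (λ { V _ → ¬vN }) , λ { H _ → h }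
      ... | no ¬v | no ¬h = let (N , ¬vN) = ¬∀⇒∃¬ em ¬v ; (M , ¬hM) = ¬∀⇒∃¬ em ¬h in
        none , N ⊔ M ,
        (λ { V _ → never V (ℕₚ.m≤m⊔n N M) ¬vN ; H _ → never H (ℕₚ.m≤n⊔m N M) ¬hM }) ,
        λ { _ () }

      dominates : ∀ c N → (∀ i → required c i ≡ true → Always i) → ∃[ k ] Dominates c N (tail N) k
      dominates none N _ = 0 , tail-unbounded N
      dominates both N always = captures both V N refl (always V refl N)
      dominates (only V) N always = captures (only V) V N refl (always V refl N)
      dominates (only H) N always = captures (only H) H N refl (always H refl N)

      plenty : ∀ c → (∀ i → required c i ≡ true → Always i) → Plenty c
      plenty c always m = tail m , target c always , tail-attached m
        where
        target : ∀ c → (∀ i → required c i ≡ true → Always i) → Target c m (tail m)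
        target none _ = Q⇒ss m (tail m) (tail-Q m)
        target both always = tail-Q m , λ i req → always i req m
        target (only _) always = tail-Q m , λ i req → always i req m

      reaches⇒leads : ∃[ c ] (Plenty c × Leads c v)
      reaches⇒leads with classify
      ... | c , N , avoids , always with dominates c N always
      ...   | k , dom = c , plenty c always , N , tail N , k , start-tail N , tail-attached N , avoids , dom

-- Complexity of the criterion

Pt-countable : Countable Pt
Pt-countable = ×-countable ℤ-countable ℤ-countable

Dir-countable : Countable Dir
Dir-countable = image-countable to from to-from (×-countable Bool-countable (×-countable Bool-countable Bool-countable))
  where
  to : Bool × Bool × Bool → Dir
  to (true , _ , ε) = flat ε
  to (false , true , ε) = up ε
  to (false , false , ε) = down ε
  from : Dir → Bool × Bool × Bool
  from (flat ε) = true , true , ε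
  from (up ε) = false , true , ε
  from (down ε) = false , false , ε
  to-from : ∀ d → to (from d) ≡ d
  to-from (flat _) = refl
  to-from (up _) = refl
  to-from (down _) = refl

Σ-lift : ∀ k {A} → IsΣ 0 A → IsΣ k A
Σ-lift zero a = a
Σ-lift (suc k) a = Σ⇒Σ (Σ-lift k a)

Σ-const : ∀ {k} {P : Set} → Dec P → IsΣ k (λ _ → P)
Σ-const P? = Σ-clopen (Clopen-const P?)

Σ-→-const : ∀ {k A} {P : Set} → Dec P → IsΣ k A → IsΣ k (λ α → P → A α)
Σ-→-const {P = P} (yes p) a = Σ-resp (λ em α → (λ x _ → x) , (λ h → h p)) a
Σ-→-const {A = A} {P} (no ¬p) a = Σ-resp {A = λ _ → ¬ P} (λ em α → (λ _ p → ⊥-elim (¬p p)) , (λ _ → ¬p)) (Σ-const (yes ¬p))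

Π-→-const : ∀ {k A} {P : Set} → Dec P → IsΠ k A → IsΠ k (λ α → P → A α)
Π-→-const P? a = Π-→ (Σ-const P?) a

Σ-Side : ∀ {k} {A : Side → Cantor → Set} → (∀ i → IsΣ k (A i)) → IsΣ k (λ α → ∀ i → A i α)
Σ-Side a = Σ-resp (λ em α → (λ { (v , h) V → v ; (v , h) H → h }) , (λ h → h V , h H)) (Σ-× (a V) (a H))

Π-Side : ∀ {k} {A : Side → Cantor → Set} → (∀ i → IsΠ k (A i)) → IsΠ k (λ α → ∀ i → A i α)
Π-Side a = Π-resp (λ em α → (λ { (v , h) V → v ; (v , h) H → h }) , (λ h → h V , h H)) (Π-× (a V) (a H))

module _ {A : Cantor → Pt → Set} (clopen : ∀ t → IsClopen (λ α → A α t)) where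

  -- Fixing the list of directions makes the condition clopen, so that the existence of a walk
  -- becomes a countable union.
  Along : Cantor → Pt → List Dir → Pt → Set
  Along α t [] u = A α t × t ≡ u
  Along α t (d ∷ ds) u = A α t × Along α (move d t) ds u

  Along-clopen : ∀ t ds u → IsClopen (λ α → Along α t ds u)
  Along-clopen t [] u = Clopen-× (clopen t) (Clopen-const (≡-dec ℤₚ._≟_ ℤₚ._≟_ t u))
  Along-clopen t (d ∷ ds) u = Clopen-× (clopen t) (Along-clopen (move d t) ds u)

  along⇒walk : ∀ {α t} ds {u} → Along α t ds u → Walk (A α) t u
  along⇒walk [] (a , refl) = stop a
  along⇒walk (d ∷ ds) (a , w) = go a d (along⇒walk ds w)

  walk⇒along : ∀ {α t u} → Walk (A α) t u → ∃[ ds ] Along α t ds u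
  walk⇒along (stop a) = [] , a , refl
  walk⇒along (go a d w) = let (ds , h) = walk⇒along w in d ∷ ds , a , h

  Σ-walk : ∀ {k} t u → IsΣ k (λ α → Walk (A α) t u)
  Σ-walk {k} t u = Σ-lift k (Σ-resp (λ em α → (λ (ds , h) → along⇒walk ds h) , walk⇒along)
    (Σ-∃ (List-countable Dir-countable) λ ds → Σ-clopen (Along-clopen t ds u)))

module Complexity (g : Pt → ℕ) where

  Bl : Cantor → Pt → Set
  Bl α t = α (g t) ≡ true

  open module C (α : Cantor) = Criterion (Bl α) public

  Bl-clopen : ∀ t → IsClopen (λ α → Bl α t)
  Bl-clopen t = Clopen-bit (g t) true

  Σ-conn : ∀ {k} n t u → IsΣ k (λ α → Conn α n t u)
  Σ-conn n = Σ-walk λ t → Clopen-× (Clopen-const (Q? n t)) (Bl-clopen t)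

  Σ-attached : ∀ {k} w → IsΣ k (λ α → Attached α w)
  Σ-attached w = Σ-∃ Pt-countable λ z → Σ-× (Σ-const (¬? (Q? 0 z))) (Σ-walk Bl-clopen w z)

  Σ-hugs : ∀ i n t → IsΣ 2 (λ α → Hugs α i n t)
  Σ-hugs i n t = Σ-∃ ℕ-countable λ b → Π⇒Σ (Π-∀ ℕ-countable λ y → Σ⇒Π (Σ-∃ Pt-countable λ f →
    Σ-× (Σ-conn n t f) (Σ-const ((coord i f ℤₚ.≤? + b) ×-dec (+ y ℤₚ.≤? ss f)))))

  Π-unbounded : ∀ n t → IsΠ 1 (λ α → Unbounded α n t)
  Π-unbounded n t = Π-∀ ℕ-countable λ y → Σ⇒Π (Σ-∃ Pt-countable λ f →
    Σ-× (Σ-conn n t f) (Σ-const (+ y ℤₚ.≤? ss f)))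

  Σ-hugging : ∀ c m w → IsΣ 2 (λ α → Hugging α c m w)
  Σ-hugging c m w = Σ-× (Σ-const (Q? m w)) (Σ-Side λ i → Σ-→-const (required c i ≟ᵇ true) (Σ-hugs i m w))

  Σ-target : ∀ c m w → IsΣ 2 (λ α → Target α c m w)
  Σ-target none m w = Σ-const (+ m ℤₚ.≤? ss w)
  Σ-target both m w = Σ-hugging both m w
  Σ-target (only i) m w = Σ-hugging (only i) m w

  Π-plenty : ∀ c → IsΠ 3 (λ α → Plenty α c)
  Π-plenty c = Π-∀ ℕ-countable λ m → Σ⇒Π (Σ-∃ Pt-countable λ w → Σ-× (Σ-target c m w) (Σ-attached w))

  -- The Σ⁰₃ hugging condition inside `Target` occurs only as a premise, so the whole stays Π⁰₃ and
  -- `Leads` stays Σ⁰₄.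
  Π-captures : ∀ c N u k → IsΠ 2 (λ α → Captures α c N u k)
  Π-captures c N u k = Π-∀ ℕ-countable λ m → Π-→-const (k ℕₚ.≤? m) (Π-∀ Pt-countable λ w →
    Π-→ (Σ-target c m w) (Π-→ (Σ-attached w) (Σ⇒Π (Σ-conn N w u))))

  Π-dominates : ∀ c N u k → IsΠ 2 (λ α → Dominates α c N u k)
  Π-dominates none N u k = Π⇒Π (Π-unbounded N u)
  Π-dominates both N u k = Π-captures both N u k
  Π-dominates (only i) N u k = Π-captures (only i) N u k

  Π-avoids : ∀ c N u → IsΠ 2 (λ α → Avoids α c N u)
  Π-avoids c N u = Π-Side λ i → Π-→-const (required c i ≟ᵇ false) (Π-¬ (Σ-hugs i N u))

  Σ-leads : ∀ c v → IsΣ 3 (λ α → Leads α c v)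
  Σ-leads c v = Σ-∃ ℕ-countable λ N → Σ-∃ Pt-countable λ u → Σ-∃ ℕ-countable λ k →
    Σ-× (Σ-walk Bl-clopen v u) (Σ-× (Σ-attached u) (Π⇒Σ (Π-× (Π-avoids c N u) (Π-dominates c N u k))))

-- The two quarter-planes

data Sign : Set where
  plus minus : Sign

sgn : Sign → ℤ → ℤ
sgn plus x = x
sgn minus x = - x

InQ : Sign → Tile → ℤ → Tile → Set
InQ plus = InQ⁺
InQ minus = InQ⁻

-- The sign `minus` adds the point reflection in the base tile. It swaps the northeast and southwest
-- quarter-planes, so `Q` describes both.
tile : Sign → Tile → Pt → Tile
tile σ (q₀ , r₀) (r , s) = q₀ +ℤ sgn σ (s - r) , r₀ +ℤ sgn σ r

point : Sign → Tile → Tile → Pt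
point σ (q₀ , r₀) (q , r) = sgn σ (r - r₀) , sgn σ ((q - q₀) +ℤ (r - r₀))

abstract
  tile-point : ∀ σ d t → tile σ d (point σ d t) ≡ t
  tile-point plus (q₀ , r₀) (q , r) = cong₂ _,_ (eq₁ q₀ r₀ q r) (eq₂ r₀ r)
    where
    eq₁ : ∀ q₀ r₀ q r → q₀ +ℤ (((q - q₀) +ℤ (r - r₀)) - (r - r₀)) ≡ q
    eq₁ = solve-∀
    eq₂ : ∀ r₀ r → r₀ +ℤ (r - r₀) ≡ r
    eq₂ = solve-∀
  tile-point minus (q₀ , r₀) (q , r) = cong₂ _,_ (eq₁ q₀ r₀ q r) (eq₂ r₀ r)
    where
    eq₁ : ∀ q₀ r₀ q r → q₀ +ℤ - (- ((q - q₀) +ℤ (r - r₀)) - - (r - r₀)) ≡ q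
    eq₁ = solve-∀
    eq₂ : ∀ r₀ r → r₀ +ℤ - - (r - r₀) ≡ r
    eq₂ = solve-∀

δ : Dir → ℤ × ℤ
δ d = move d (0ℤ , 0ℤ)

move-δ : ∀ d t → move d t ≡ (rr (δ d) +ℤ rr t , ss (δ d) +ℤ ss t)
move-δ (flat true) (r , s) = cong (_ ,_) (sym (ℤₚ.+-identityˡ s))
move-δ (flat false) (r , s) = cong (_ ,_) (sym (ℤₚ.+-identityˡ s))
move-δ (up true) (r , s) = refl
move-δ (up false) (r , s) = refl
move-δ (down true) (r , s) = refl
move-δ (down false) (r , s) = refl

step⇒δ : ∀ σ {x y} → Step x y → ∃[ d ] (rr (δ d) ≡ sgn σ y × ss (δ d) ≡ sgn σ (x +ℤ y))
step⇒δ plus ne = up false , refl , refl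
step⇒δ plus sw = down false , refl , refl
step⇒δ plus north = up true , refl , refl
step⇒δ plus south = down true , refl , refl
step⇒δ plus se = flat false , refl , refl
step⇒δ plus nw = flat true , refl , refl
step⇒δ minus ne = down false , refl , refl
step⇒δ minus sw = up false , refl , refl
step⇒δ minus north = down true , refl , refl
step⇒δ minus south = up true , refl , refl
step⇒δ minus se = flat true , refl , refl
step⇒δ minus nw = flat false , refl , refl

δ⇒step : ∀ σ d → Step (sgn σ (ss (δ d) - rr (δ d))) (sgn σ (rr (δ d)))
δ⇒step plus (flat true) = nw
δ⇒step plus (flat false) = se
δ⇒step plus (up true) = north
δ⇒step plus (up false) = ne
δ⇒step plus (down true) = south
δ⇒step plus (down false) = sw
δ⇒step minus (flat true) = se
δ⇒step minus (flat false) = nw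
δ⇒step minus (up true) = south
δ⇒step minus (up false) = sw
δ⇒step minus (down true) = north
δ⇒step minus (down false) = ne

abstract
  point-step : ∀ σ d₀ t t′ → Adjacent t t′ → ∃[ d ] (point σ d₀ t′ ≡ move d (point σ d₀ t))
  point-step σ d₀@(q₀ , r₀) t@(q , r) t′@(q′ , r′) adj with step⇒δ σ adj
  ... | d , e₁ , e₂ = d , trans (cong₂ _,_ (trans (eqr σ) (cong (_+ℤ _) (sym e₁))) (trans (eqs σ) (cong (_+ℤ _) (sym e₂))))
      (sym (move-δ d (point σ d₀ t)))
    where
    eqr₊ : ∀ r₀ r r′ → r′ - r₀ ≡ (r′ - r) +ℤ (r - r₀)
    eqr₊ = solve-∀
    eqr₋ : ∀ r₀ r r′ → - (r′ - r₀) ≡ - (r′ - r) +ℤ - (r - r₀)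
    eqr₋ = solve-∀
    eqr : ∀ σ → sgn σ (r′ - r₀) ≡ sgn σ (r′ - r) +ℤ sgn σ (r - r₀)
    eqr plus = eqr₊ r₀ r r′
    eqr minus = eqr₋ r₀ r r′
    eqs₊ : ∀ q₀ r₀ q r q′ r′ → (q′ - q₀) +ℤ (r′ - r₀) ≡ ((q′ - q) +ℤ (r′ - r)) +ℤ ((q - q₀) +ℤ (r - r₀))
    eqs₊ = solve-∀
    eqs₋ : ∀ q₀ r₀ q r q′ r′ → - ((q′ - q₀) +ℤ (r′ - r₀)) ≡ - ((q′ - q) +ℤ (r′ - r)) +ℤ - ((q - q₀) +ℤ (r - r₀))
    eqs₋ = solve-∀
    eqs : ∀ σ → sgn σ ((q′ - q₀) +ℤ (r′ - r₀)) ≡ sgn σ ((q′ - q) +ℤ (r′ - r)) +ℤ sgn σ ((q - q₀) +ℤ (r - r₀))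
    eqs plus = eqs₊ q₀ r₀ q r q′ r′
    eqs minus = eqs₋ q₀ r₀ q r q′ r′

  tile-step : ∀ σ d₀ d t → Adjacent (tile σ d₀ t) (tile σ d₀ (move d t))
  tile-step σ d₀@(q₀ , r₀) d t@(r , s) rewrite move-δ d t = subst₂ Step (eqq σ) (eqr σ) (δ⇒step σ d)
    where
    x y : ℤ
    x = rr (δ d)
    y = ss (δ d)
    eqq₊ : ∀ q₀ r s x y → y - x ≡ (q₀ +ℤ ((y +ℤ s) - (x +ℤ r))) - (q₀ +ℤ (s - r))
    eqq₊ = solve-∀
    eqq₋ : ∀ q₀ r s x y → - (y - x) ≡ (q₀ +ℤ - ((y +ℤ s) - (x +ℤ r))) - (q₀ +ℤ - (s - r))
    eqq₋ = solve-∀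
    eqq : ∀ σ → sgn σ (y - x) ≡ (q₀ +ℤ sgn σ ((y +ℤ s) - (x +ℤ r))) - (q₀ +ℤ sgn σ (s - r))
    eqq plus = eqq₊ q₀ r s x y
    eqq minus = eqq₋ q₀ r s x y
    eqr₊ : ∀ r₀ r x → x ≡ (r₀ +ℤ (x +ℤ r)) - (r₀ +ℤ r)
    eqr₊ = solve-∀
    eqr₋ : ∀ r₀ r x → - x ≡ (r₀ +ℤ - (x +ℤ r)) - (r₀ +ℤ - r)
    eqr₋ = solve-∀
    eqr : ∀ σ → sgn σ x ≡ (r₀ +ℤ sgn σ (x +ℤ r)) - (r₀ +ℤ sgn σ r)
    eqr plus = eqr₊ r₀ r x
    eqr minus = eqr₋ r₀ r x

InQ⇒coord : ∀ σ d₀ k t → InQ σ d₀ (sgn σ k) t → ∀ i → k ≤ℤ coord i (point σ d₀ t)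
InQ⇒coord plus (q₀ , r₀) k (q , r) (h , _) V = by-gap (eq q₀ r₀ k q r) (gap h)
  where eq : ∀ q₀ r₀ k q r → q - (q₀ +ℤ k) ≡ (((q - q₀) +ℤ (r - r₀)) - (r - r₀)) - k
        eq = solve-∀
InQ⇒coord plus (q₀ , r₀) k (q , r) (_ , h) H = by-gap (eq q₀ r₀ k q r) (gap h)
  where eq : ∀ q₀ r₀ k q r → ((r +ℤ r) +ℤ q) - ((r₀ +ℤ r₀) +ℤ (q₀ +ℤ k)) ≡ (((q - q₀) +ℤ (r - r₀)) +ℤ (r - r₀)) - k
        eq = solve-∀
InQ⇒coord minus (q₀ , r₀) k (q , r) (h , _) V = by-gap (eq q₀ r₀ k q r) (gap h)
  where eq : ∀ q₀ r₀ k q r → (q₀ +ℤ - k) - q ≡ (- ((q - q₀) +ℤ (r - r₀)) - - (r - r₀)) - k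
        eq = solve-∀
InQ⇒coord minus (q₀ , r₀) k (q , r) (_ , h) H = by-gap (eq q₀ r₀ k q r) (gap h)
  where eq : ∀ q₀ r₀ k q r → ((r₀ +ℤ r₀) +ℤ (q₀ +ℤ - k)) - ((r +ℤ r) +ℤ q) ≡ (- ((q - q₀) +ℤ (r - r₀)) +ℤ - (r - r₀)) - k
        eq = solve-∀

coord⇒InQ : ∀ σ d₀ m k t → sgn σ m ≤ℤ k → (∀ i → k ≤ℤ coord i t) → InQ σ d₀ m (tile σ d₀ t)
coord⇒InQ plus (q₀ , r₀) m k (r , s) m≤k h =
  by-gap (eq₁ q₀ m k r s) (gap m≤k ⊕ gap (h V)) , by-gap (eq₂ q₀ r₀ m k r s) (gap m≤k ⊕ gap (h H))
  where
  eq₁ : ∀ q₀ m k r s → (k - m) +ℤ ((s - r) - k) ≡ (q₀ +ℤ (s - r)) - (q₀ +ℤ m)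
  eq₁ = solve-∀
  eq₂ : ∀ q₀ r₀ m k r s → (k - m) +ℤ ((s +ℤ r) - k) ≡
    (((r₀ +ℤ r) +ℤ (r₀ +ℤ r)) +ℤ (q₀ +ℤ (s - r))) - ((r₀ +ℤ r₀) +ℤ (q₀ +ℤ m))
  eq₂ = solve-∀
coord⇒InQ minus (q₀ , r₀) m k (r , s) m≤k h =
  by-gap (eq₁ q₀ m k r s) (gap m≤k ⊕ gap (h V)) , by-gap (eq₂ q₀ r₀ m k r s) (gap m≤k ⊕ gap (h H))
  where
  eq₁ : ∀ q₀ m k r s → (k - - m) +ℤ ((s - r) - k) ≡ (q₀ +ℤ m) - (q₀ +ℤ - (s - r))
  eq₁ = solve-∀
  eq₂ : ∀ q₀ r₀ m k r s → (k - - m) +ℤ ((s +ℤ r) - k) ≡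
    ((r₀ +ℤ r₀) +ℤ (q₀ +ℤ m)) - (((r₀ +ℤ - r) +ℤ (r₀ +ℤ - r)) +ℤ (q₀ +ℤ - (s - r)))
  eq₂ = solve-∀

opposite : Sign → Sign
opposite plus = minus
opposite minus = plus

-- Index one is taken because the tile `d₀` belongs to both quarter-planes of index 0.
outside : ∀ σ d₀ t → InQ (opposite σ) d₀ (sgn (opposite σ) 1ℤ) t → ¬ Q 0 (point σ d₀ t)
outside plus d₀@(q₀ , r₀) t@(q , r) h q0 = absurd-gap (eq q₀ r₀ q r) (gap (InQ⇒coord minus d₀ 1ℤ t h V) ⊕ gap (q0 V))
  where eq : ∀ q₀ r₀ q r → ((- ((q - q₀) +ℤ (r - r₀)) - - (r - r₀)) - 1ℤ) +ℤ ((((q - q₀) +ℤ (r - r₀)) - (r - r₀)) - 0ℤ) ≡ -[1+ 0 ]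
        eq = solve-∀
outside minus d₀@(q₀ , r₀) t@(q , r) h q0 = absurd-gap (eq q₀ r₀ q r) (gap (InQ⇒coord plus d₀ 1ℤ t h V) ⊕ gap (q0 V))
  where eq : ∀ q₀ r₀ q r → ((((q - q₀) +ℤ (r - r₀)) - (r - r₀)) - 1ℤ) +ℤ ((- ((q - q₀) +ℤ (r - r₀)) - - (r - r₀)) - 0ℤ) ≡ -[1+ 0 ]
        eq = solve-∀

-- The winning set

module Winner (e : ℕ ↔ Tile) (d₀ : Tile) where

  color : Cantor → Coloring
  color α t = α (Inverse.from e t)

  g : Sign → Pt → ℕ
  g σ p = Inverse.from e (tile σ d₀ p)

  record Ray (σ : Sign) (α : Cantor) (v : Tile) : Set where
    constructor ray
    field
      tiles : ℕ → Tile
      start-tile : tiles 0 ≡ v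
      is-path : IsPath tiles
      is-black : IsBlack (color α) tiles
      reaches : ReachesTo (InQ σ) d₀ tiles

  module S (σ : Sign) = Complexity (g σ)

  Bσ : Sign → Cantor → Pt → Set
  Bσ σ α = S.Bl σ α

  black-point : ∀ σ {α t} → color α t ≡ true → Bσ σ α (point σ d₀ t)
  black-point σ {α} {t} h = trans (cong (color α) (tile-point σ d₀ t)) h

  ray⇒reaches : ∀ σ {α v} → Ray σ α v → Reaches (Bσ σ α) (point σ d₀ v)
  ray⇒reaches σ {α} (ray t t0 p b r) = record
    { path = λ k → point σ d₀ (t k)
    ; path-start = cong (point σ d₀) t0
    ; path-step = λ k → point-step σ d₀ (t k) (t (suc k)) (p k)
    ; path-black = λ k → black-point σ {α} (b k)
    ; path-reach = λ n → let (k , h) = r (sgn σ (+ n)) in k , λ l k≤l → InQ⇒coord σ d₀ (+ n) (t l) (h l k≤l) }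

  sgn≤∣∣ : ∀ σ m → sgn σ m ≤ℤ + ∣ m ∣
  sgn≤∣∣ plus m = i≤+∣i∣ m
  sgn≤∣∣ minus m = subst (λ k → - m ≤ℤ + k) (ℤₚ.∣-i∣≡∣i∣ m) (i≤+∣i∣ (- m))

  reaches⇒ray : ∀ σ {α v} → Reaches (Bσ σ α) (point σ d₀ v) → Ray σ α v
  reaches⇒ray σ {α} {v} ρ = ray (λ k → tile σ d₀ (path ρ k))
    (trans (cong (tile σ d₀) (path-start ρ)) (tile-point σ d₀ v))
    (λ k → let (d , eq) = path-step ρ k in
      subst (λ p → Adjacent (tile σ d₀ (path ρ k)) (tile σ d₀ p)) (sym eq) (tile-step σ d₀ d (path ρ k)))
    (path-black ρ)
    (λ m → let (k , h) = path-reach ρ ∣ m ∣ in k , λ l k≤l →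
      coord⇒InQ σ d₀ m (+ ∣ m ∣) (path ρ l) (sgn≤∣∣ σ m) (h l k≤l))

  -- The ray towards the opposite end eventually runs outside `Q 0` and is itself the required walk.
  ray⇒attached : ∀ σ {α v} → Ray (opposite σ) α v → S.Attached σ α (point σ d₀ v)
  ray⇒attached σ {α} (ray t refl p b r) = let (k , h) = r (sgn (opposite σ) 1ℤ) in
    point σ d₀ (t k) , outside σ d₀ (t k) (h k ℕₚ.≤-refl) ,
    path-walk {f = λ k → point σ d₀ (t k)} (λ j → point-step σ d₀ (t j) (t (suc j)) (p j)) (λ j _ → black-point σ {α} (b j)) z≤n

  Win : Case → Case → Cantor → Set
  Win c c′ α = S.Plenty plus α c × S.Plenty minus α c′ ×
    ∃[ v ] (S.Leads plus α c (point plus d₀ v) × S.Leads minus α c′ (point minus d₀ v))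

  rays⇒W : ∀ {α v} → Ray plus α v → Ray minus α v → W e d₀ α
  rays⇒W (ray t t0 p b r) (ray t′ t0′ p′ b′ r′) = t , t′ , p , b , r , p′ , b′ , r′ , trans t0 (sym t0′)

  W⇒rays : ∀ {α} → W e d₀ α → ∃[ v ] (Ray plus α v × Ray minus α v)
  W⇒rays (t , t′ , p , b , r , p′ , b′ , r′ , t0≡) = t 0 , ray t refl p b r , ray t′ (sym t0≡) p′ b′ r′

  win⇒W : EM → ∀ {α} → ∃[ c ] ∃[ c′ ] Win c c′ α → W e d₀ α
  win⇒W em {α} (c , c′ , P , P′ , v , L , L′) = rays⇒W {α} {v}
    (reaches⇒ray plus {α} {v} (S.leads⇒reaches plus α em c (point plus d₀ v) P L))
    (reaches⇒ray minus {α} {v} (S.leads⇒reaches minus α em c′ (point minus d₀ v) P′ L′))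

  -- Each ray is used twice: to reach its own end, and to attach the other ray to the boundary.
  W⇒win : EM → ∀ {α} → W e d₀ α → ∃[ c ] ∃[ c′ ] Win c c′ α
  W⇒win em {α} w =
    let (v , R , R′) = W⇒rays {α} w
        (c , P , L) = S.reaches⇒leads plus α em (ray⇒attached plus {α} R′) (ray⇒reaches plus {α} R)
        (c′ , P′ , L′) = S.reaches⇒leads minus α em (ray⇒attached minus {α} R) (ray⇒reaches minus {α} R′)
    in c , c′ , P , P′ , v , L , L′

  Σ-win-point : ∀ c c′ → IsΣ 3 (λ α → ∃[ v ] (S.Leads plus α c (point plus d₀ v) × S.Leads minus α c′ (point minus d₀ v)))
  -- Tiles and points are both pairs of integers, so `Pt-countable` also enumerates the common
  -- starting tile.
  Σ-win-point c c′ = Σ-∃ Pt-countable λ v → Σ-× (S.Σ-leads plus c (point plus d₀ v)) (S.Σ-leads minus c′ (point minus d₀ v))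

  Σ-win : ∀ c c′ → IsΣ 4 (Win c c′)
  Σ-win c c′ = Σ-× (Π⇒Σ (S.Π-plenty plus c)) (Σ-× (Π⇒Σ (S.Π-plenty minus c′)) (Σ⇒Σ (Σ-win-point c c′)))

  Π-win : ∀ c c′ → IsΠ 4 (Win c c′)
  Π-win c c′ = Π-× (Π⇒Π (S.Π-plenty plus c)) (Π-× (Π⇒Π (S.Π-plenty minus c′)) (Σ⇒Π (Σ-win-point c c′)))

-- Finite unions over the cases

fromBools : Bool → Bool → Case
fromBools true true = both
fromBools true false = only V
fromBools false true = only H
fromBools false false = none

toBools : Case → Bool × Bool
toBools both = true , true
toBools (only V) = true , false
toBools (only H) = false , true
toBools none = false , false

from-toBools : ∀ c → fromBools (proj₁ (toBools c)) (proj₂ (toBools c)) ≡ c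
from-toBools both = refl
from-toBools (only V) = refl
from-toBools (only H) = refl
from-toBools none = refl

Case-countable : Countable Case
Case-countable = image-countable (λ (a , b) → fromBools a b) toBools from-toBools (×-countable Bool-countable Bool-countable)

Π-∃-Case : ∀ {k} {A : Case → Cantor → Set} → (∀ c → IsΠ k (A c)) → IsΠ k (λ α → ∃[ c ] A c α)
Π-∃-Case {A = A} a = Π-resp
  (λ em α → (λ (x , y , h) → fromBools x y , h) ,
    (λ (c , h) → proj₁ (toBools c) , proj₂ (toBools c) , subst (λ c → A c α) (sym (from-toBools c)) h))
  (Π-∃-finite λ x → Π-∃-finite λ y → a (fromBools x y))

theorem1 : (e : ℕ ↔ Tile) (d0 : Tile) → LightfaceΔ 4 (W e d0)
theorem1 e d0 = IsΣ.codeΣ σ , IsΠ.codeΠ π , λ em → IsΣ.correctΣ σ em , IsΠ.correctΠ π em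
  where
  open Winner e d0
  W-win : EM → ∀ α → (∃[ c ] ∃[ c′ ] Win c c′ α) ⇔ W e d0 α
  W-win em α = win⇒W em {α} , W⇒win em {α}
  σ : IsΣ 4 (W e d0)
  σ = Σ-resp W-win (Σ-∃ Case-countable λ c → Σ-∃ Case-countable λ c′ → Σ-win c c′)
  π : IsΠ 4 (W e d0)
  π = Π-resp W-win (Π-∃-Case λ c → Π-∃-Case λ c′ → Π-win c c′)
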